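{- $\cong_{\mathcal{CM}_1}\ \equiv_c\ E_{\min}$.
   Context: $W_e$ denotes the $e$-th c.e. set. $\mathcal{CM}$ is the variety of commutative monoids (binary operation and identity constant). Fix a computable bijective coding of pairs of terms over the single generator $x_0$ by natural numbers; $\mathcal{CM}_1[e]$ is the term algebra over $\{x_0\}$ modulo the smallest congruence containing the pairs coded in $W_e$ and all instances of the commutative monoid laws, and $e\cong_{\mathcal{CM}_1}i$ iff $\mathcal{CM}_1[e]\cong\mathcal{CM}_1[i]$. $e\,E_{\min}\,i$ iff $\min W_e=\min W_i$ or $W_e=W_i=\emptyset$. For equivalence relations $E,F$ on $\mathbb N$, $E\le_c F$ means there is a total computable $h$ with $x\,E\,y\iff h(x)\,F\,h(y)$; $E\equiv_c F$ means $E\le_c F$ and $F\le_c E$. -}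

module Defs where

open import Data.Nat using (ℕ; zero; suc; _<_; _≟_)
open import Data.Bool using (Bool; true; false; if_then_else_)
open import Data.Product using (Σ; _×_; _,_; proj₁; proj₂)
open import Data.Sum using (_⊎_)
open import Data.Maybe using (Maybe; just; nothing)
open import Data.List using (List; []; _∷_)
open import Relation.Nullary using (¬_; yes; no)
open import Relation.Binary.PropositionalEquality using (_≡_)

-- Bijective pairing  ⟨a , b⟩ = 2^a * (2b+1) - 1 , and its inverse.

half : ℕ → ℕ
half zero = zero
half (suc zero) = zero
half (suc (suc n)) = suc (half n)

isEven : ℕ → Bool
isEven zero = true
isEven (suc zero) = false
isEven (suc (suc n)) = isEven n

val2 : ℕ → ℕ → ℕ × ℕ
val2 zero n = zero , n
val2 (suc f) zero = zero , zero
val2 (suc f) (suc n) with isEven (suc n)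
... | true  = let r = val2 f (half (suc n)) in suc (proj₁ r) , proj₂ r
... | false = zero , suc n

-- unpair m = (a , b)  with  m + 1 = 2^a * (2b+1)
unpair : ℕ → ℕ × ℕ
unpair m = let r = val2 (suc m) (suc m) in proj₁ r , half (proj₂ r)

data Instr : Set where
  inc : ℕ → ℕ → Instr          -- inc k j   : R[k] := R[k]+1 ; goto j
  dec : ℕ → ℕ → ℕ → Instr      -- dec k j l : if R[k] = 0 goto l else R[k] := R[k]-1 ; goto j

Program : Set
Program = List Instr

Regs : Set
Regs = ℕ → ℕ

decodeInstr : ℕ → Instr
decodeInstr a with isEven a
... | true  = let p = unpair (half a) in inc (proj₁ p) (proj₂ p)
... | false = let p = unpair (half a)
                  q = unpair (proj₂ p)
              in dec (proj₁ p) (proj₁ q) (proj₂ q)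

decodeList : ℕ → ℕ → Program
decodeList zero _ = []
decodeList (suc f) zero = []
decodeList (suc f) (suc m) = let p = unpair m in decodeInstr (proj₁ p) ∷ decodeList f (proj₂ p)

-- the e-th program (a computable surjection ℕ → Program)
program : ℕ → Program
program e = decodeList e e

nth : Program → ℕ → Maybe Instr
nth [] _ = nothing
nth (i ∷ p) zero = just i
nth (i ∷ p) (suc n) = nth p n

set : Regs → ℕ → ℕ → Regs
set r k v n with n ≟ k
... | yes _ = v
... | no  _ = r n

run : ℕ → Program → ℕ → Regs → Maybe Regs
run zero p pc r = nothing
run (suc f) p pc r with nth p pc
... | nothing = just r
... | just (inc k j) = run f p j (set r k (suc (r k)))
... | just (dec k j l) with r k
...   | zero  = run f p l r
...   | suc v = run f p j (set r k v)

initRegs : ℕ → Regs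
initRegs x zero = x
initRegs x (suc _) = zero

_⟨_⟩↓_ : ℕ → ℕ → ℕ → Set
e ⟨ x ⟩↓ y = Σ ℕ λ fuel → Σ Regs λ r →
  (run fuel (program e) zero (initRegs x) ≡ just r) × (r zero ≡ y)

_∈W_ : ℕ → ℕ → Set
x ∈W e = Σ ℕ λ y → e ⟨ x ⟩↓ y

Computable : (ℕ → ℕ) → Set
Computable h = Σ ℕ λ e → ∀ x → e ⟨ x ⟩↓ h x

Rel₀ : Set₁
Rel₀ = ℕ → ℕ → Set

_≤c_ : Rel₀ → Rel₀ → Set
E ≤c F = Σ (ℕ → ℕ) λ h → Computable h ×
  (∀ x y → (E x y → F (h x) (h y)) × (F (h x) (h y) → E x y))

_≡c_ : Rel₀ → Rel₀ → Set
E ≡c F = (E ≤c F) × (F ≤c E)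

IsMinW : ℕ → ℕ → Set
IsMinW e m = (m ∈W e) × (∀ k → k < m → ¬ (k ∈W e))

EmptyW : ℕ → Set
EmptyW e = ∀ x → ¬ (x ∈W e)

Emin : Rel₀
Emin e i = (Σ ℕ λ m → IsMinW e m × IsMinW i m) ⊎ (EmptyW e × EmptyW i)

infixl 7 _·_
data Term : Set where
  x₀  : Term
  ε   : Term
  _·_ : Term → Term → Term

-- bijective coding ℕ → Term : 0 ↦ x₀, 1 ↦ ε, m+2 ↦ t_a · t_b with (a,b) = unpair m
decodeTermF : ℕ → ℕ → Term
decodeTermF _ zero = x₀
decodeTermF _ (suc zero) = ε
decodeTermF zero (suc (suc m)) = x₀   -- unreachable with enough fuel
decodeTermF (suc f) (suc (suc m)) =
  let p = unpair m in decodeTermF f (proj₁ p) · decodeTermF f (proj₂ p)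

decodeTerm : ℕ → Term
decodeTerm n = decodeTermF n n

decodePair : ℕ → Term × Term
decodePair n = let p = unpair n in decodeTerm (proj₁ p) , decodeTerm (proj₂ p)

data _≈[_]_ : Term → ℕ → Term → Set where
  ax    : ∀ {e n s t} → n ∈W e → decodePair n ≡ (s , t) → s ≈[ e ] t
  refl  : ∀ {e s} → s ≈[ e ] s
  sym   : ∀ {e s t} → s ≈[ e ] t → t ≈[ e ] s
  trans : ∀ {e s t u} → s ≈[ e ] t → t ≈[ e ] u → s ≈[ e ] u
  cong· : ∀ {e s s' t t'} → s ≈[ e ] s' → t ≈[ e ] t' → (s · t) ≈[ e ] (s' · t')
  assoc : ∀ {e s t u} → ((s · t) · u) ≈[ e ] (s · (t · u))
  comm  : ∀ {e s t} → (s · t) ≈[ e ] (t · s)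
  idˡ   : ∀ {e s} → (ε · s) ≈[ e ] s
  idʳ   : ∀ {e s} → (s · ε) ≈[ e ] s

-- monoid isomorphism CM_1[e] ≅ CM_1[i] (maps between the quotients, given on representatives)
record CM₁Iso (e i : ℕ) : Set where
  field
    f     : Term → Term
    g     : Term → Term
    f-resp : ∀ {s t} → s ≈[ e ] t → f s ≈[ i ] f t
    g-resp : ∀ {s t} → s ≈[ i ] t → g s ≈[ e ] g t
    f-·   : ∀ s t → f (s · t) ≈[ i ] (f s · f t)
    f-ε   : f ε ≈[ i ] ε
    gf    : ∀ s → g (f s) ≈[ e ] s
    fg    : ∀ t → f (g t) ≈[ i ] t

_≅CM₁_ : Rel₀
e ≅CM₁ i = CM₁Iso e i

{-# OPTIONS --safe #-}
module Submission where

-- A one-generated commutative monoid is ℕ modulo a congruence ~.  An isomorphism may move the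
-- generator, but then to a k-th power with k invertible up to ~, so isomorphic presentations
-- define the same congruence.  A congruence is determined by the least pair (i , p), for a
-- pairing increasing in both arguments, such that i ~ i + p + 1, and the set of these pairs is
-- enumerable: a pair is certified by finitely many applications of the enumerated axioms.
-- Conversely, the equations xⁿ = xⁿ⁺¹ for n in W identify exactly the powers xⁿ with n ≥ min W.
-- For the reductions to be computable, primitive recursive functions are compiled to register
-- machines; a step-bounded universal machine is one of these functions, and the index of the
-- set to be enumerated is passed on by a loader appended to a fixed search program.

open import Defs
open import Level using (0ℓ)
open import Axiom.ExcludedMiddle using (ExcludedMiddle)

open import Data.Bool using (true; false)
open import Data.Empty using (⊥-elim)
open import Data.List using ([]; _∷_; _++_; length)
open import Data.List.Properties using (length-++)
open import Data.Maybe using (Maybe; just; nothing)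
open import Data.Nat
open import Data.Nat.Properties
open import Data.Nat.DivMod using (_%_; _/_; m≡m%n+[m/n]*n; m%n<n)
open import Data.Product using (∃; ∃₂; _×_; _,_; proj₁; proj₂)
open import Data.Sum using (_⊎_; inj₁; inj₂)
open import Data.Unit using (⊤; tt)
open import Relation.Binary.Construct.Closure.Equivalence using (EqClosure)
open import Relation.Binary.Construct.Closure.ReflexiveTransitive using (ε; _◅_; _◅◅_)
open import Relation.Binary.Construct.Closure.Symmetric using (fwd; bwd)
import Relation.Binary.Construct.Closure.Equivalence as Eq
open import Relation.Binary using (tri<; tri≈; tri>)
open import Relation.Nullary using (¬_; yes; no)
open import Relation.Binary.PropositionalEquality
  using (_≡_; _≢_; refl; cong; cong₂; subst; subst₂)
  renaming (sym to ≡-sym; trans to ≡-trans)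

-- The pairing over which the minimum is taken is the inverse `pair` of the fixed coding `unpair`.
-- Its monotonicity makes the least code meaningful: a nontrivial relation at an exponent `a < i`
-- would force `a ~ a + p + 1`, and a period not divisible by `p + 1` would leave a shorter one at
-- `i`; either gives a smaller code. So the least code consists of the index and the period of the
-- congruence, and these generate it. The shift from `p` to `p + 1` leaves out the trivial
-- relations, so that the empty set stands for equality of exponents. Both reductions come from
-- `enumerate`: a primitive recursive test of `(x , e , t)` becomes a set enumerated uniformly in
-- `e`, an s-m-n theorem for this machine model. Excluded middle is used only to produce proofs of
-- `Emin`, a disjunction that requires deciding whether an enumerable set is empty and locating its
-- minimum; the reductions themselves are computable.

iterate : ∀ {A : Set} → (A → A) → ℕ → A → A
iterate f zero    a = a
iterate f (suc n) a = f (iterate f n a)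

iterate-suc : ∀ {A : Set} (f : A → A) n a → iterate f (suc n) a ≡ iterate f n (f a)
iterate-suc f zero    a = refl
iterate-suc f (suc n) a = cong f (iterate-suc f n a)

iterate-fixed : ∀ {A : Set} (f : A → A) {a} → f a ≡ a → ∀ n → iterate f n a ≡ a
iterate-fixed f fa zero    = refl
iterate-fixed f fa (suc n) = ≡-trans (cong f (iterate-fixed f fa n)) fa

-- Register machines

set-same : ∀ r k v → set r k v k ≡ v
set-same r k v with k ≟ k
... | yes _ = refl
... | no k≢k = ⊥-elim (k≢k refl)

set-other : ∀ r k v {n} → n ≢ k → set r k v n ≡ r n
set-other r k v {n} n≢k with n ≟ k
... | yes n≡k = ⊥-elim (n≢k n≡k)
... | no _ = refl

run-halt : ∀ {p pc} r f → nth p pc ≡ nothing → run (suc f) p pc r ≡ just r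
run-halt r f eq rewrite eq = refl

run-mono : ∀ g m p pc r {s} → run g p pc r ≡ just s → run (g + m) p pc r ≡ just s
run-mono (suc g) m p pc r eq with nth p pc
... | nothing = eq
... | just (inc k j) = run-mono g m p j _ eq
... | just (dec k j l) with r k
...   | zero  = run-mono g m p l _ eq
...   | suc v = run-mono g m p j _ eq

-- An equation valid for every remaining fuel, rather than an implication between halting runs, so
-- that it can be used in both directions.
Steps : ℕ → Program → ℕ → Regs → ℕ → Regs → Set
Steps k p pc r pc' r' = ∀ f → run (k + f) p pc r ≡ run f p pc' r'

Reach : Program → ℕ → Regs → ℕ → Regs → Set
Reach p pc r pc' r' = ∃ λ k → Steps k p pc r pc' r'

reach-refl : ∀ {p pc r} → Reach p pc r pc r
reach-refl = 0 , λ f → refl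

reach-trans : ∀ {p pc r pc' r' pc'' r''} →
              Reach p pc r pc' r' → Reach p pc' r' pc'' r'' → Reach p pc r pc'' r''
reach-trans {p} {pc} {r} (k , q) (k' , q') =
  k + k' , λ f → ≡-trans (cong (λ n → run n p pc r) (+-assoc k k' f)) (≡-trans (q (k' + f)) (q' f))

reach-inc : ∀ {p pc k j} r → nth p pc ≡ just (inc k j) → Reach p pc r j (set r k (suc (r k)))
reach-inc {p} {pc} {k} {j} r eq = 1 , step
  where
  step : Steps 1 p pc r j (set r k (suc (r k)))
  step f rewrite eq = refl

reach-zero : ∀ {p pc k j l} r → nth p pc ≡ just (dec k j l) → r k ≡ 0 → Reach p pc r l r
reach-zero {p} {pc} {l = l} r eq rk = 1 , step
  where
  step : Steps 1 p pc r l r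
  step f rewrite eq | rk = refl

reach-suc : ∀ {p pc k j l v} r → nth p pc ≡ just (dec k j l) → r k ≡ suc v →
            Reach p pc r j (set r k v)
reach-suc {p} {pc} {k} {j} {v = v} r eq rk = 1 , step
  where
  step : Steps 1 p pc r j (set r k v)
  step f rewrite eq | rk = refl

-- If `g` were below `k`, monotonicity would give a result with fuel `k` as well; but `Steps` at
-- `f = 0` equates that run with one without fuel, which is `nothing`.
steps-back : ∀ {p pc r pc' r' s} k → Steps k p pc r pc' r' → ∀ g → run g p pc r ≡ just s →
             ∃ λ g' → g ≡ k + g' × run g' p pc' r' ≡ just s
steps-back {p} {pc} {r} k st g eq with k ≤? g
... | yes k≤g = g ∸ k , g≡ , ≡-trans (≡-sym (st (g ∸ k))) (≡-trans (cong (λ n → run n p pc r) (≡-sym g≡)) eq)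
  where g≡ = ≡-sym (m+[n∸m]≡n k≤g)
... | no k≰g with ≡-trans (≡-sym (st 0)) (≡-trans (cong (λ n → run n p pc r) k≡) (run-mono g (k ∸ g) p pc r eq))
  where k≡ = ≡-trans (+-identityʳ k) (≡-sym (m+[n∸m]≡n (<⇒≤ (≰⇒> k≰g))))
... | ()

CodeAt : Program → ℕ → Program → Set
CodeAt p b []       = ⊤
CodeAt p b (i ∷ is) = nth p b ≡ just i × CodeAt p (suc b) is

codeAt-++ : ∀ {p} xs {ys b} → CodeAt p b (xs ++ ys) → CodeAt p b xs × CodeAt p (length xs + b) ys
codeAt-++ []       at = tt , at
codeAt-++ {p} (x ∷ xs) {ys} {b} (eq , at) with codeAt-++ xs at
... | atx , aty = (eq , atx) , subst (λ n → CodeAt p n ys) (+-suc (length xs) b) aty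

codeAt-∷ : ∀ {i p b} zs → CodeAt p b zs → CodeAt (i ∷ p) (suc b) zs
codeAt-∷ []       _         = tt
codeAt-∷ (z ∷ zs) (eq , at) = eq , codeAt-∷ zs at

codeAt-suffix : ∀ xs ys → CodeAt (xs ++ ys) (length xs) ys
codeAt-suffix []       []       = tt
codeAt-suffix []       (y ∷ ys) = refl , codeAt-∷ ys (codeAt-suffix [] ys)
codeAt-suffix (x ∷ xs) ys       = codeAt-∷ ys (codeAt-suffix xs ys)

nth-length : ∀ p → nth p (length p) ≡ nothing
nth-length []      = refl
nth-length (_ ∷ p) = nth-length p

-- Structured programs

infixr 5 _⨾_
data Cmd : Set where
  skip : Cmd
  incr : ℕ → Cmd
  _⨾_  : Cmd → Cmd → Cmd
  loop : ℕ → Cmd → Cmd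

size : Cmd → ℕ
size skip       = 0
size (incr k)   = 1
size (c ⨾ d)    = size d + size c
size (loop k c) = suc (suc (size c))

-- The loop test is repeated after the body, so that no unconditional jump is needed.
assemble : Cmd → ℕ → Program
assemble skip       b = []
assemble (incr k)   b = inc k (suc b) ∷ []
assemble (c ⨾ d)    b = assemble c b ++ assemble d (size c + b)
assemble (loop k c) b = test ∷ assemble c (suc b) ++ test ∷ []
  where test = dec k (suc b) (suc (suc (size c + b)))

length-assemble : ∀ c b → length (assemble c b) ≡ size c
length-assemble skip       b = refl
length-assemble (incr k)   b = refl
length-assemble (c ⨾ d)    b = ≡-trans (length-++ (assemble c b))
  (≡-trans (cong₂ _+_ (length-assemble c b) (length-assemble d _)) (+-comm (size c) (size d)))
length-assemble (loop k c) b = cong suc (≡-trans (length-++ (assemble c (suc b)))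
  (≡-trans (cong (_+ 1) (length-assemble c (suc b))) (+-comm (size c) 1)))

data _/_⇓_ : Cmd → Regs → Regs → Set where
  skip⇓ : ∀ {r} → skip / r ⇓ r
  incr⇓ : ∀ {r k} → incr k / r ⇓ set r k (suc (r k))
  seq⇓  : ∀ {r r' r'' c d} → c / r ⇓ r' → d / r' ⇓ r'' → (c ⨾ d) / r ⇓ r''
  done⇓ : ∀ {r k c} → r k ≡ 0 → loop k c / r ⇓ r
  loop⇓ : ∀ {r r' r'' k c v} → r k ≡ suc v → c / set r k v ⇓ r' → loop k c / r' ⇓ r'' →
          loop k c / r ⇓ r''

mutual
  assemble-sound : ∀ {c r r' p} b → c / r ⇓ r' → CodeAt p b (assemble c b) →
                   Reach p b r (size c + b) r'
  assemble-sound b skip⇓ at = reach-refl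
  assemble-sound b (incr⇓ {r}) (eq , _) = reach-inc r eq
  assemble-sound {p = p} b (seq⇓ {r' = r'} {r''} {c} {d} x y) at with codeAt-++ (assemble c b) at
  ... | atc , atd = reach-trans (assemble-sound b x atc)
    (subst (λ n → Reach p (size c + b) r' n r'') (≡-sym (+-assoc (size d) (size c) b))
      (assemble-sound (size c + b) y
        (subst (λ n → CodeAt p n (assemble d (size c + b))) (cong (_+ b) (length-assemble c b)) atd)))
  assemble-sound {loop k c} {p = p} b x (eq , at) with codeAt-++ (assemble c (suc b)) at
  ... | atc , (eq' , _) = loop-sound b x atc eq
    (≡-trans (cong (nth p) (≡-sym (≡-trans (cong (_+ suc b) (length-assemble c (suc b))) (+-suc (size c) b)))) eq')

  -- The entry point `q` may be either copy of the test: the first round enters at the copy before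
  -- the body, every later round at the copy after it.
  loop-sound : ∀ {k c r r' p q} b → loop k c / r ⇓ r' → CodeAt p (suc b) (assemble c (suc b)) →
               let test = just (dec k (suc b) (suc (suc (size c + b)))) in
               nth p q ≡ test → nth p (suc (size c + b)) ≡ test →
               Reach p q r (suc (suc (size c + b))) r'
  loop-sound b (done⇓ {r} rk) at eq eq' = reach-zero r eq rk
  loop-sound {c = c} {p = p} b (loop⇓ {r} {r'} {k = k} {v = v} rk x y) at eq eq' =
    reach-trans (reach-suc r eq rk)
      (reach-trans (subst (λ n → Reach p (suc b) (set r k v) n r') (+-suc (size c) b) (assemble-sound (suc b) x at))
        (loop-sound b y at eq' eq'))

-- `I v` is the invariant with `v` rounds left. The body starts after the test has decremented
-- register `k`, and must end with the same value in it.
loop-rule : ∀ {k c} (I : ℕ → Regs → Set) →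
  (∀ v r → r k ≡ suc v → I (suc v) r → ∃ λ r' → c / set r k v ⇓ r' × r' k ≡ v × I v r') →
  ∀ n r → r k ≡ n → I n r → ∃ λ r' → loop k c / r ⇓ r' × r' k ≡ 0 × I 0 r'
loop-rule I body zero    r rk i = r , done⇓ rk , rk , i
loop-rule I body (suc n) r rk i with body n r rk i
... | r' , x , rk' , i' with loop-rule I body n r' rk' i'
... | r'' , y , rk'' , i'' = r'' , loop⇓ rk x y , rk'' , i''

clear : ℕ → Cmd
clear k = loop k skip

clear-spec : ∀ k r → ∃ λ r' → clear k / r ⇓ r' × r' k ≡ 0 × (∀ j → j ≢ k → r' j ≡ r j)
clear-spec k r = loop-rule (λ _ s → ∀ j → j ≢ k → s j ≡ r j)
  (λ v s _ i → set s k v , skip⇓ , set-same s k v , λ j j≢k → ≡-trans (set-other s k v j≢k) (i j j≢k))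
  (r k) r refl (λ j _ → refl)

-- Reading a register empties it, so the value is moved to `d` and to the scratch register `t` at
-- once, then moved back from `t`.
copy : ℕ → ℕ → ℕ → Cmd
copy s d t = clear d ⨾ clear t ⨾ loop s (incr d ⨾ incr t) ⨾ loop t (incr s)

opaque
  duplicate-spec : ∀ s d t r → s ≢ d → s ≢ t → d ≢ t → r d ≡ 0 → r t ≡ 0 →
    ∃ λ r' → loop s (incr d ⨾ incr t) / r ⇓ r' × r' s ≡ 0 × r' d ≡ r s × r' t ≡ r s
             × (∀ j → j ≢ s → j ≢ d → j ≢ t → r' j ≡ r j)
  duplicate-spec s d t r s≢d s≢t d≢t rd rt
    with loop-rule I body (r s) r refl
           (≡-trans (cong (r s +_) rd) (+-identityʳ _) , ≡-trans rt (≡-sym rd) , λ j _ _ _ → refl)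
    where
    I : ℕ → Regs → Set
    I n q = n + q d ≡ r s × q t ≡ q d × (∀ j → j ≢ s → j ≢ d → j ≢ t → q j ≡ r j)
    body : ∀ v q → q s ≡ suc v → I (suc v) q →
           ∃ λ q' → (incr d ⨾ incr t) / set q s v ⇓ q' × q' s ≡ v × I v q'
    body v q qs (sum , td , o) = q₂ , seq⇓ incr⇓ incr⇓ ,
      ≡-trans (set-other q₁ t _ s≢t) (≡-trans (set-other q₀ d _ s≢d) (set-same q s v)) ,
      (≡-trans (cong (v +_) qd) (≡-trans (+-suc v (q d)) sum) ,
      ≡-trans qt (≡-sym qd) ,
      λ j js jd jt → ≡-trans (set-other q₁ t _ jt) (≡-trans (set-other q₀ d _ jd)
        (≡-trans (set-other q s v js) (o j js jd jt))))
      where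
      q₀ q₁ q₂ : Regs
      q₀ = set q s v
      q₁ = set q₀ d (suc (q₀ d))
      q₂ = set q₁ t (suc (q₁ t))
      qd : q₂ d ≡ suc (q d)
      qd = ≡-trans (set-other q₁ t _ d≢t) (≡-trans (set-same q₀ d _)
             (cong suc (set-other q s v (λ e → s≢d (≡-sym e)))))
      qt : q₂ t ≡ suc (q d)
      qt = ≡-trans (set-same q₁ t _) (cong suc (≡-trans (set-other q₀ d _ (λ e → d≢t (≡-sym e)))
             (≡-trans (set-other q s v (λ e → s≢t (≡-sym e))) td)))
  ... | r' , x , s₀ , (sum , td , o) = r' , x , s₀ , sum , ≡-trans td sum , o

  restore-spec : ∀ s t r → s ≢ t → r s ≡ 0 →
    ∃ λ r' → loop t (incr s) / r ⇓ r' × r' s ≡ r t × (∀ j → j ≢ s → j ≢ t → r' j ≡ r j)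
  restore-spec s t r s≢t rs
    with loop-rule I body (r t) r refl (≡-trans (cong (r t +_) rs) (+-identityʳ _) , λ j _ _ → refl)
    where
    I : ℕ → Regs → Set
    I n q = n + q s ≡ r t × (∀ j → j ≢ s → j ≢ t → q j ≡ r j)
    body : ∀ v q → q t ≡ suc v → I (suc v) q →
           ∃ λ q' → incr s / set q t v ⇓ q' × q' t ≡ v × I v q'
    body v q qt (sum , o) = set q₀ s (suc (q₀ s)) , incr⇓ ,
      ≡-trans (set-other q₀ s _ (λ e → s≢t (≡-sym e))) (set-same q t v) ,
      (≡-trans (cong (v +_) (≡-trans (set-same q₀ s _) (cong suc (set-other q t v s≢t))))
        (≡-trans (+-suc v (q s)) sum) ,
      λ j js jt → ≡-trans (set-other q₀ s _ js) (≡-trans (set-other q t v jt) (o j js jt)))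
      where
      q₀ : Regs
      q₀ = set q t v
  ... | r' , x , _ , (sum , o) = r' , x , sum , o

  copy-spec : ∀ s d t r → s ≢ d → s ≢ t → d ≢ t →
              ∃ λ r' → copy s d t / r ⇓ r' × r' d ≡ r s × (∀ j → j ≢ d → j ≢ t → r' j ≡ r j)
  copy-spec s d t r s≢d s≢t d≢t
    with clear-spec d r
  ... | r₁ , x₁ , d₁ , o₁
    with clear-spec t r₁
  ... | r₂ , x₂ , t₂ , o₂
    with duplicate-spec s d t r₂ s≢d s≢t d≢t (≡-trans (o₂ d d≢t) d₁) t₂
  ... | r₃ , x₃ , s₃ , d₃ , t₃ , o₃
    with restore-spec s t r₃ s≢t s₃
  ... | r₄ , x₄ , s₄ , o₄ =
    r₄ , seq⇓ x₁ (seq⇓ x₂ (seq⇓ x₃ x₄)) ,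
    ≡-trans (o₄ d (λ e → s≢d (≡-sym e)) d≢t) (≡-trans d₃ unchanged) , frame
    where
    unchanged : r₂ s ≡ r s
    unchanged = ≡-trans (o₂ s s≢t) (o₁ s s≢d)
    frame : ∀ j → j ≢ d → j ≢ t → r₄ j ≡ r j
    frame j jd jt with j ≟ s
    ... | yes refl = ≡-trans s₄ (≡-trans t₃ unchanged)
    ... | no js = ≡-trans (o₄ j js jt) (≡-trans (o₃ j js jd jt) (≡-trans (o₂ j jt) (o₁ j jd)))

-- Primitive recursion on tuples

infixr 6 _⊗_
data Ty : Set where
  nat : Ty
  _⊗_ : Ty → Ty → Ty

⟦_⟧ : Ty → Set
⟦ nat ⟧   = ℕ
⟦ A ⊗ B ⟧ = ⟦ A ⟧ × ⟦ B ⟧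

infixr 9 _∘_
data Fn : Ty → Ty → Set where
  id    : ∀ {A} → Fn A A
  _∘_   : ∀ {A B C} → Fn B C → Fn A B → Fn A C
  ⟨_,_⟩ : ∀ {A B C} → Fn A B → Fn A C → Fn A (B ⊗ C)
  fst   : ∀ {A B} → Fn (A ⊗ B) A
  snd   : ∀ {A B} → Fn (A ⊗ B) B
  zero  : ∀ {A} → Fn A nat
  suc   : Fn nat nat
  iter  : ∀ {A} → Fn A A → Fn (nat ⊗ A) A

eval : ∀ {A B} → Fn A B → ⟦ A ⟧ → ⟦ B ⟧
eval id        x       = x
eval (f ∘ g)   x       = eval f (eval g x)
eval ⟨ f , g ⟩ x       = eval f x , eval g x
eval fst       (x , y) = x
eval snd       (x , y) = y
eval zero      x       = 0
eval suc       x       = suc x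
eval (iter f)  (n , x) = iterate (eval f) n x

-- Blocks of registers and compilation

Block : Ty → Set
Block nat     = ℕ
Block (A ⊗ B) = Block A × Block B

width : Ty → ℕ
width nat     = 1
width (A ⊗ B) = width A + width B

fresh : ∀ A → ℕ → Block A
fresh nat     t = t
fresh (A ⊗ B) t = fresh A t , fresh B (width A + t)

In : ∀ A → ℕ → Block A → Set
In nat     j k       = j ≡ k
In (A ⊗ B) j (x , y) = In A j x ⊎ In B j y

Holds : ∀ A → Regs → Block A → ⟦ A ⟧ → Set
Holds nat     r k       v       = r k ≡ v
Holds (A ⊗ B) r (x , y) (u , v) = Holds A r x u × Holds B r y v

Below : ∀ A → Block A → ℕ → Set
Below A x t = ∀ j → In A j x → j < t

Disjoint : ∀ A B → Block A → Block B → Set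
Disjoint A B x y = ∀ j → In A j x → ¬ In B j y

Distinct : ∀ A → Block A → Set
Distinct nat     _       = ⊤
Distinct (A ⊗ B) (x , y) = Distinct A x × Distinct B y × Disjoint A B x y

fresh-bounds : ∀ A t j → In A j (fresh A t) → t ≤ j × j < width A + t
fresh-bounds nat     t j refl = ≤-refl , ≤-refl
fresh-bounds (A ⊗ B) t j (inj₁ i) with fresh-bounds A t j i
... | lo , hi = lo , ≤-trans hi (+-monoˡ-≤ t (m≤m+n (width A) (width B)))
fresh-bounds (A ⊗ B) t j (inj₂ i) with fresh-bounds B (width A + t) j i
... | lo , hi = ≤-trans (m≤n+m t (width A)) lo , ≤-trans hi (≤-reflexive
  (≡-trans (≡-sym (+-assoc (width B) (width A) t)) (cong (_+ t) (+-comm (width B) (width A)))))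

fresh-distinct : ∀ A t → Distinct A (fresh A t)
fresh-distinct nat     t = tt
fresh-distinct (A ⊗ B) t = fresh-distinct A t , fresh-distinct B (width A + t) ,
  λ j a b → <⇒≱ (proj₂ (fresh-bounds A t j a)) (proj₁ (fresh-bounds B (width A + t) j b))

below-fresh-disjoint : ∀ A B x {t} → Below A x t → Disjoint A B x (fresh B t)
below-fresh-disjoint A B x x<t j i i' = <⇒≱ (x<t j i) (proj₁ (fresh-bounds B _ j i'))

below-mono : ∀ A x {t} n → Below A x t → Below A x (n + t)
below-mono A x {t} n x<t j i = ≤-trans (x<t j i) (m≤n+m t n)

fresh-below : ∀ A t → Below A (fresh A t) (width A + t)
fresh-below A t j i = proj₂ (fresh-bounds A t j i)

disjoint-sym : ∀ A B x y → Disjoint A B x y → Disjoint B A y x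
disjoint-sym A B x y d j i i' = d j i' i

holds-agree : ∀ A {r r'} x {v} → Holds A r x v → (∀ j → In A j x → r' j ≡ r j) → Holds A r' x v
holds-agree nat     k       h        agree = ≡-trans (agree k refl) h
holds-agree (A ⊗ B) (x , y) (h , h') agree =
  holds-agree A x h (λ j i → agree j (inj₁ i)) , holds-agree B y h' (λ j i → agree j (inj₂ i))

-- `t` is the first scratch register: whatever lies from `t` on may be overwritten, whatever lies
-- below it outside the destination survives. This is what allows compiled pieces to be run one
-- after another.
Transfers : ∀ A B → Cmd → Block A → Block B → ℕ → ⟦ A ⟧ → ⟦ B ⟧ → Set
Transfers A B c s d t a b = ∀ r → Holds A r s a →
  ∃ λ r' → c / r ⇓ r' × Holds B r' d b × (∀ j → j < t → ¬ In B j d → r' j ≡ r j)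

copyBlock : ∀ A → Block A → Block A → ℕ → Cmd
copyBlock nat     s         d         t = copy s d t
copyBlock (A ⊗ B) (s₁ , s₂) (d₁ , d₂) t = copyBlock A s₁ d₁ t ⨾ copyBlock B s₂ d₂ t

copyBlock-transfers : ∀ A s d t a → Below A s t → Below A d t → Distinct A d → Disjoint A A s d →
                      Transfers A A (copyBlock A s d t) s d t a a
copyBlock-transfers nat s d t a s<t d<t _ dis r h
  with copy-spec s d t r (dis s refl) (<⇒≢ (s<t s refl)) (<⇒≢ (d<t d refl))
... | r' , x , e , o = r' , x , ≡-trans e h , λ j j<t j≢d → o j j≢d (<⇒≢ j<t)
copyBlock-transfers (A ⊗ B) (s₁ , s₂) (d₁ , d₂) t (a , b) s<t d<t (dd₁ , dd₂ , d₁d₂) dis r (h₁ , h₂)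
  with copyBlock-transfers A s₁ d₁ t a (λ j i → s<t j (inj₁ i)) (λ j i → d<t j (inj₁ i)) dd₁
         (λ j i i' → dis j (inj₁ i) (inj₁ i')) r h₁
... | r₁ , x₁ , e₁ , o₁
  with copyBlock-transfers B s₂ d₂ t b (λ j i → s<t j (inj₂ i)) (λ j i → d<t j (inj₂ i)) dd₂
         (λ j i i' → dis j (inj₂ i) (inj₂ i')) r₁
         (holds-agree B s₂ h₂ (λ j i → o₁ j (s<t j (inj₂ i)) (λ i' → dis j (inj₂ i) (inj₁ i'))))
... | r₂ , x₂ , e₂ , o₂ = r₂ , seq⇓ x₁ x₂ ,
  (holds-agree A d₁ e₁ (λ j i → o₂ j (d<t j (inj₁ i)) (d₁d₂ j i)) , e₂) ,
  λ j j<t ¬i → ≡-trans (o₂ j j<t (λ i → ¬i (inj₂ i))) (o₁ j j<t (λ i → ¬i (inj₁ i)))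

compile : ∀ {A B} → Fn A B → Block A → Block B → ℕ → Cmd
compile {A} id  s d t = copyBlock A s d t
compile {A} {C} (_∘_ {B = B} f g) s d t =
  compile g s m (width B + t) ⨾ compile f m d (width B + t)
  where m = fresh B t
compile ⟨ f , g ⟩ s (d₁ , d₂) t = compile f s d₁ t ⨾ compile g s d₂ t
compile {B = B} fst (s₁ , s₂) d t = copyBlock B s₁ d t
compile {B = B} snd (s₁ , s₂) d t = copyBlock B s₂ d t
compile zero s d t = clear d
compile suc  s d t = copy s d t ⨾ incr d
-- Register `t` counts the rounds. Compiled code needs disjoint source and destination, so each
-- round computes from `d` into the fresh block `m` and copies the result back.
compile {B = A} (iter f) (n , s) d t =
  copy n t (suc t) ⨾ copyBlock A s d (suc t) ⨾ loop t (compile f d m t' ⨾ copyBlock A m d t')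
  where m  = fresh A (suc t)
        t' = width A + suc t

compile-transfers : ∀ {A B} (f : Fn A B) s d t a → Below A s t → Below B d t → Distinct B d →
                    Disjoint A B s d → Transfers A B (compile f s d t) s d t a (eval f a)
compile-transfers id s d t a s<t d<t dd dis = copyBlock-transfers _ s d t a s<t d<t dd dis
compile-transfers {A} {C} (_∘_ {B = B} f g) s d t a s<t d<t dd dis r h
  with compile-transfers g s (fresh B t) (width B + t) a (below-mono A s (width B) s<t)
         (fresh-below B t) (fresh-distinct B t) (below-fresh-disjoint A B s s<t) r h
... | r₁ , x₁ , e₁ , o₁
  with compile-transfers f (fresh B t) d (width B + t) (eval g a) (fresh-below B t)
         (below-mono C d (width B) d<t) dd (disjoint-sym C B d _ (below-fresh-disjoint C B d d<t)) r₁ e₁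
... | r₂ , x₂ , e₂ , o₂ = r₂ , seq⇓ x₁ x₂ , e₂ ,
  λ j j<t ¬i → ≡-trans (o₂ j (≤-trans j<t (m≤n+m t (width B))) ¬i)
    (o₁ j (≤-trans j<t (m≤n+m t (width B))) (λ i → <⇒≱ j<t (proj₁ (fresh-bounds B t j i))))
compile-transfers {A} (⟨_,_⟩ {B = B} {C} f g) s (d₁ , d₂) t a s<t d<t (dd₁ , dd₂ , d₁d₂) dis r h
  with compile-transfers f s d₁ t a s<t (λ j i → d<t j (inj₁ i)) dd₁ (λ j i i' → dis j i (inj₁ i')) r h
... | r₁ , x₁ , e₁ , o₁
  with compile-transfers g s d₂ t a s<t (λ j i → d<t j (inj₂ i)) dd₂ (λ j i i' → dis j i (inj₂ i')) r₁
         (holds-agree A s h (λ j i → o₁ j (s<t j i) (λ i' → dis j i (inj₁ i'))))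
... | r₂ , x₂ , e₂ , o₂ = r₂ , seq⇓ x₁ x₂ ,
  (holds-agree B d₁ e₁ (λ j i → o₂ j (d<t j (inj₁ i)) (d₁d₂ j i)) , e₂) ,
  λ j j<t ¬i → ≡-trans (o₂ j j<t (λ i → ¬i (inj₂ i))) (o₁ j j<t (λ i → ¬i (inj₁ i)))
compile-transfers fst (s₁ , s₂) d t (a , b) s<t d<t dd dis r (h₁ , h₂) =
  copyBlock-transfers _ s₁ d t a (λ j i → s<t j (inj₁ i)) d<t dd (λ j i → dis j (inj₁ i)) r h₁
compile-transfers snd (s₁ , s₂) d t (a , b) s<t d<t dd dis r (h₁ , h₂) =
  copyBlock-transfers _ s₂ d t b (λ j i → s<t j (inj₂ i)) d<t dd (λ j i → dis j (inj₂ i)) r h₂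
compile-transfers zero s d t a s<t d<t dd dis r h with clear-spec d r
... | r' , x , e , o = r' , x , e , λ j _ j≢d → o j j≢d
compile-transfers suc s d t a s<t d<t dd dis r h
  with copyBlock-transfers nat s d t a s<t d<t dd dis r h
... | r' , x , e , o = set r' d (suc (r' d)) , seq⇓ x incr⇓ ,
  ≡-trans (set-same r' d _) (cong suc e) ,
  λ j j<t j≢d → ≡-trans (set-other r' d _ j≢d) (o j j<t j≢d)
compile-transfers {B = A} (iter f) (n , s) d t (N , a) s<t d<t dd dis r (hn , hs)
  with copy-spec n t (suc t) r (<⇒≢ (s<t n (inj₁ refl)))
         (<⇒≢ (m<n⇒m<1+n (s<t n (inj₁ refl)))) (<⇒≢ (n<1+n t))
... | r₁ , x₁ , e₁ , o₁
  with copyBlock-transfers A s d (suc t) a (below-mono A s 1 (λ j i → s<t j (inj₂ i)))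
         (below-mono A d 1 d<t) dd (λ j i → dis j (inj₂ i)) r₁
         (holds-agree A s hs (λ j i → let j<t = s<t j (inj₂ i) in o₁ j (<⇒≢ j<t) (<⇒≢ (m<n⇒m<1+n j<t))))
... | r₂ , x₂ , e₂ , o₂
  with loop-rule I body N r₂ (≡-trans (o₂ t ≤-refl (λ i → <⇒≢ (d<t t i) refl)) (≡-trans e₁ hn))
         (a , e₂ , refl , λ j j<t ¬i → ≡-trans (o₂ j (m<n⇒m<1+n j<t) ¬i) (o₁ j (<⇒≢ j<t) (<⇒≢ (m<n⇒m<1+n j<t))))
  where
  I : ℕ → Regs → Set
  -- The invariant speaks of the work that remains: `v` further rounds from the current value `b`
  -- give the final result.
  I v q = ∃ λ b → Holds A q d b × iterate (eval f) v b ≡ iterate (eval f) N a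
            × (∀ j → j < t → ¬ In A j d → q j ≡ r j)
  m  = fresh A (suc t)
  t' = width A + suc t
  t<t' : suc t ≤ t'
  t<t' = m≤n+m (suc t) (width A)
  d<t' : Below A d t'
  d<t' = λ j i → ≤-trans (d<t j i) (≤-trans (n≤1+n t) t<t')
  d⊥m : Disjoint A A d m
  d⊥m = below-fresh-disjoint A A d (below-mono A d 1 d<t)
  t∉d : ¬ In A t d
  t∉d i = <⇒≢ (d<t t i) refl
  t∉m : ∀ j → j ≤ t → ¬ In A j m
  t∉m j j≤t i = <⇒≱ (proj₁ (fresh-bounds A (suc t) j i)) j≤t
  body : ∀ v q → q t ≡ suc v → I (suc v) q →
         ∃ λ q' → (compile f d m t' ⨾ copyBlock A m d t') / set q t v ⇓ q' × q' t ≡ v × I v q'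
  body v q qt (b , hb , eq , o)
    with compile-transfers f d m t' b d<t' (fresh-below A (suc t)) (fresh-distinct A (suc t)) d⊥m
           (set q t v) (holds-agree A d hb (λ j i → set-other q t v (<⇒≢ (d<t j i))))
  ... | q₁ , y₁ , h₁ , p₁
    with copyBlock-transfers A m d t' (eval f b) (fresh-below A (suc t)) d<t' dd
           (disjoint-sym A A d m d⊥m) q₁ h₁
  ... | q₂ , y₂ , h₂ , p₂ = q₂ , seq⇓ y₁ y₂ ,
    ≡-trans (p₂ t t<t' t∉d) (≡-trans (p₁ t t<t' (t∉m t ≤-refl)) (set-same q t v)) ,
    eval f b , h₂ , ≡-trans (≡-sym (iterate-suc (eval f) v b)) eq ,
    λ j j<t ¬i → let j<t' = ≤-trans (m<n⇒m<1+n j<t) t<t' in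
      ≡-trans (p₂ j j<t' ¬i) (≡-trans (p₁ j j<t' (t∉m j (<⇒≤ j<t)))
        (≡-trans (set-other q t v (<⇒≢ j<t)) (o j j<t ¬i)))
... | r₃ , x₃ , _ , (b , hb , eq , o) =
  r₃ , seq⇓ x₁ (seq⇓ x₂ x₃) , subst (Holds A r₃ d) eq hb , o

-- Primitive recursive functions and basic arithmetic

record PrimRec {A B : Ty} (f : ⟦ A ⟧ → ⟦ B ⟧) : Set where
  constructor realised
  field
    fn    : Fn A B
    sound : ∀ x → eval fn x ≡ f x

open PrimRec

infixr 9 _⊙_
infixr 6 _▵_

idᵖ : ∀ {A} → PrimRec {A} {A} (λ x → x)
idᵖ = realised id λ _ → refl

π₁ : ∀ {A B} → PrimRec {A ⊗ B} {A} proj₁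
π₁ = realised fst λ _ → refl

π₂ : ∀ {A B} → PrimRec {A ⊗ B} {B} proj₂
π₂ = realised snd λ _ → refl

zeroᵖ : ∀ {A} → PrimRec {A} {nat} (λ _ → 0)
zeroᵖ = realised zero λ _ → refl

sucᵖ : PrimRec {nat} {nat} suc
sucᵖ = realised suc λ _ → refl

_⊙_ : ∀ {A B C} {f : ⟦ B ⟧ → ⟦ C ⟧} {g : ⟦ A ⟧ → ⟦ B ⟧} →
      PrimRec {B} {C} f → PrimRec {A} {B} g → PrimRec {A} {C} (λ x → f (g x))
_⊙_ {f = f} F G = realised (fn F ∘ fn G) λ x → ≡-trans (sound F _) (cong f (sound G x))

_▵_ : ∀ {A B C} {f : ⟦ A ⟧ → ⟦ B ⟧} {g : ⟦ A ⟧ → ⟦ C ⟧} →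
      PrimRec {A} {B} f → PrimRec {A} {C} g → PrimRec {A} {B ⊗ C} (λ x → f x , g x)
F ▵ G = realised ⟨ fn F , fn G ⟩ λ x → cong₂ _,_ (sound F x) (sound G x)

-- Functions are realised up to pointwise equality only, so a program may follow a different
-- recursion from the one that defines the function.
extᵖ : ∀ {A B} {f g : ⟦ A ⟧ → ⟦ B ⟧} → PrimRec {A} {B} f → (∀ x → f x ≡ g x) → PrimRec {A} {B} g
extᵖ F fg = realised (fn F) λ x → ≡-trans (sound F x) (fg x)

constᵖ : ∀ {A} n → PrimRec {A} {nat} (λ _ → n)
constᵖ zero    = zeroᵖ
constᵖ (suc n) = sucᵖ ⊙ constᵖ n

-- `iter` knows no parameters, so the argument `x` is carried along unchanged in the iterated pair.
iterᵖ : ∀ {A B} {n : ⟦ A ⟧ → ℕ} {base : ⟦ A ⟧ → ⟦ B ⟧} {step : ⟦ A ⊗ B ⟧ → ⟦ B ⟧} →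
        PrimRec {A} {nat} n → PrimRec {A} {B} base → PrimRec {A ⊗ B} {B} step →
        PrimRec {A} {B} (λ x → iterate (λ b → step (x , b)) (n x) (base x))
iterᵖ {A} {B} {n} {base} {step} N F S =
  realised (snd ∘ iter ⟨ fst , fn S ⟩ ∘ ⟨ fn N , ⟨ id , fn F ⟩ ⟩) λ x →
    ≡-trans (cong proj₂ (unfold x (eval (fn N) x) (eval (fn F) x)))
      (cong₂ (iterate (λ b → step (x , b))) (sound N x) (sound F x))
  where
  unfold : ∀ x k b → iterate (eval ⟨ fst , fn S ⟩) k (x , b) ≡ (x , iterate (λ b → step (x , b)) k b)
  unfold x zero    b = refl
  unfold x (suc k) b = ≡-trans (cong (eval ⟨ fst , fn S ⟩) (unfold x k b)) (cong (x ,_) (sound S _))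

cond : ∀ {A : Set} → ℕ → A → A → A
cond zero    a b = a
cond (suc _) a b = b

-- A case distinction is an iteration of a constant function: no round keeps the starting value
-- `f x`, any positive number of rounds gives `g x`.
condᵖ : ∀ {A B} {n : ⟦ A ⟧ → ℕ} {f g : ⟦ A ⟧ → ⟦ B ⟧} →
        PrimRec {A} {nat} n → PrimRec {A} {B} f → PrimRec {A} {B} g →
        PrimRec {A} {B} (λ x → cond (n x) (f x) (g x))
condᵖ {n = n} {f} {g} N F G = extᵖ (iterᵖ N F (G ⊙ π₁)) λ x → select (n x) (f x) (g x)
  where
  select : ∀ {C : Set} k (a b : C) → iterate (λ _ → b) k a ≡ cond k a b
  select zero    a b = refl
  select (suc k) a b = refl

addᵖ : PrimRec {nat ⊗ nat} {nat} (λ x → proj₁ x + proj₂ x)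
addᵖ = extᵖ (iterᵖ π₁ π₂ (sucᵖ ⊙ π₂)) λ x → iterate-suc≡+ (proj₁ x) (proj₂ x)
  where
  iterate-suc≡+ : ∀ m n → iterate suc m n ≡ m + n
  iterate-suc≡+ zero    n = refl
  iterate-suc≡+ (suc m) n = cong suc (iterate-suc≡+ m n)

-- Kleene's predecessor: the pair `(pred k , k)` is advanced `n` times.
predᵖ : PrimRec {nat} {nat} pred
predᵖ = extᵖ (π₁ ⊙ iterᵖ idᵖ (zeroᵖ ▵ zeroᵖ) (π₂ ⊙ π₂ ▵ sucᵖ ⊙ π₂ ⊙ π₂)) λ n → cong proj₁ (count n)
  where
  count : ∀ n → iterate (λ b → proj₂ b , suc (proj₂ b)) n (0 , 0) ≡ (pred n , n)
  count zero    = refl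
  count (suc n) = cong (λ b → proj₂ b , suc (proj₂ b)) (count n)

monusᵖ : PrimRec {nat ⊗ nat} {nat} (λ x → proj₁ x ∸ proj₂ x)
monusᵖ = extᵖ (iterᵖ π₂ π₁ (predᵖ ⊙ π₂)) λ x → iterate-pred (proj₁ x) (proj₂ x)
  where
  iterate-pred : ∀ m n → iterate pred n m ≡ m ∸ n
  iterate-pred m zero    = refl
  iterate-pred m (suc n) = ≡-trans (cong pred (iterate-pred m n)) (pred[m∸n]≡m∸[1+n] m n)

-- The absolute difference, which serves as an equality test for `cond`.
dist : ℕ → ℕ → ℕ
dist m n = (m ∸ n) + (n ∸ m)

dist-self : ∀ m → dist m m ≡ 0
dist-self m = cong₂ _+_ (n∸n≡0 m) (n∸n≡0 m)

dist-zero : ∀ m n → dist m n ≡ 0 → m ≡ n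
dist-zero m n e = ≤-antisym (m∸n≡0⇒m≤n (m+n≡0⇒m≡0 _ e)) (m∸n≡0⇒m≤n (m+n≡0⇒n≡0 (m ∸ n) e))

distᵖ : PrimRec {nat ⊗ nat} {nat} (λ x → dist (proj₁ x) (proj₂ x))
distᵖ = addᵖ ⊙ (monusᵖ ▵ monusᵖ ⊙ (π₂ ▵ π₁))

-- Pairing

double : ℕ → ℕ
double n = iterate (λ k → suc (suc k)) n 0

par : ℕ → ℕ
par zero          = 0
par (suc zero)    = 1
par (suc (suc n)) = par n

half-double : ∀ n → half (double n) ≡ n
half-double zero    = refl
half-double (suc n) = cong suc (half-double n)

half-suc-double : ∀ n → half (suc (double n)) ≡ n
half-suc-double zero    = refl
half-suc-double (suc n) = cong suc (half-suc-double n)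

isEven-double : ∀ n → isEven (double n) ≡ true
isEven-double zero    = refl
isEven-double (suc n) = isEven-double n

isEven-suc-double : ∀ n → isEven (suc (double n)) ≡ false
isEven-suc-double zero    = refl
isEven-suc-double (suc n) = isEven-suc-double n

par-double : ∀ n → par (double n) ≡ 0
par-double zero    = refl
par-double (suc n) = par-double n

par-suc-double : ∀ n → par (suc (double n)) ≡ 1
par-suc-double zero    = refl
par-suc-double (suc n) = par-suc-double n

n≤double : ∀ n → n ≤ double n
n≤double zero    = z≤n
n≤double (suc n) = s≤s (m≤n⇒m≤1+n (n≤double n))

double-mono : ∀ {m n} → m ≤ n → double m ≤ double n
double-mono z≤n       = z≤n
double-mono (s≤s m≤n) = s≤s (s≤s (double-mono m≤n))

double-mono-< : ∀ {m n} → m < n → double m < double n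
double-mono-< {m} m<n = ≤-trans (n≤1+n _) (double-mono m<n)

even-or-odd : ∀ n → ∃ λ k → n ≡ double k ⊎ n ≡ suc (double k)
even-or-odd zero = 0 , inj₁ refl
even-or-odd (suc n) with even-or-odd n
... | k , inj₁ refl = k , inj₂ refl
... | k , inj₂ refl = suc k , inj₁ refl

doubleᵖ : PrimRec {nat} {nat} double
doubleᵖ = iterᵖ idᵖ zeroᵖ (sucᵖ ⊙ sucᵖ ⊙ π₂)

half-parᵖ : PrimRec {nat} {nat ⊗ nat} (λ n → half n , par n)
half-parᵖ = extᵖ (iterᵖ idᵖ (zeroᵖ ▵ zeroᵖ)
                   (condᵖ (π₂ ⊙ π₂) (π₁ ⊙ π₂ ▵ constᵖ 1) (sucᵖ ⊙ π₁ ⊙ π₂ ▵ zeroᵖ))) count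
  where
  step : ℕ × ℕ → ℕ × ℕ
  step (h , q) = cond q (h , 1) (suc h , 0)
  two-steps : ∀ n h → step (step (h , par n)) ≡ (suc h , par n)
  two-steps zero          h = refl
  two-steps (suc zero)    h = refl
  two-steps (suc (suc n)) h = two-steps n h
  count : ∀ n → iterate step n (0 , 0) ≡ (half n , par n)
  count zero          = refl
  count (suc zero)    = refl
  count (suc (suc n)) = ≡-trans (cong (λ b → step (step b)) (count n)) (two-steps n (half n))

halfᵖ : PrimRec {nat} {nat} half
halfᵖ = π₁ ⊙ half-parᵖ

parᵖ : PrimRec {nat} {nat} par
parᵖ = π₂ ⊙ half-parᵖ

-- Opaque, because nested pairs with small literals already evaluate to astronomical numbers.
opaque
  pair : ℕ → ℕ → ℕ
  pair a b = iterate (λ n → suc (double n)) a (double b)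

  +≤pair : ∀ a b → a + b ≤ pair a b
  +≤pair zero    b = n≤double b
  +≤pair (suc a) b = s≤s (≤-trans (+≤pair a b) (n≤double _))

  fst≤pair : ∀ a b → a ≤ pair a b
  fst≤pair a b = ≤-trans (m≤m+n a b) (+≤pair a b)

  snd≤pair : ∀ a b → b ≤ pair a b
  snd≤pair a b = ≤-trans (m≤n+m b a) (+≤pair a b)

  pair-monoʳ-< : ∀ a {b b'} → b < b' → pair a b < pair a b'
  pair-monoʳ-< zero    b<b' = double-mono-< b<b'
  pair-monoʳ-< (suc a) b<b' = s≤s (double-mono-< (pair-monoʳ-< a b<b'))

  pair-monoˡ-< : ∀ {a a'} b → a < a' → pair a b < pair a' b
  pair-monoˡ-< {a} {suc a'} b (s≤s a≤a') with m≤n⇒m<n∨m≡n a≤a'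
  ... | inj₁ a<a' = <-trans (pair-monoˡ-< b a<a') (s≤s (n≤double _))
  ... | inj₂ refl = s≤s (n≤double _)

  -- Each round of `pair` sends `n` to `2n + 1` and so doubles the successor; hence `suc (pair a b)`
  -- is `2^a (2b + 1)`, and `val2` strips one factor 2 per unit of fuel.
  val2-pair : ∀ f a b → a < f → val2 f (suc (pair a b)) ≡ (a , suc (double b))
  val2-pair (suc f) zero    b a<f rewrite isEven-suc-double b = refl
  val2-pair (suc f) (suc a) b (s≤s a<f)
    rewrite isEven-double (pair a b) | half-double (pair a b) | val2-pair f a b a<f = refl

  unpair-pair : ∀ a b → unpair (pair a b) ≡ (a , b)
  unpair-pair a b rewrite val2-pair (suc (pair a b)) a b (s≤s (fst≤pair a b)) | half-suc-double b = refl

  pair-surjective : ∀ m → ∃₂ λ a b → m ≡ pair a b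
  pair-surjective m = go m m ≤-refl
    where
    go : ∀ f m → m ≤ f → ∃₂ λ a b → m ≡ pair a b
    go f m m≤f with even-or-odd m
    ... | k , inj₁ refl = 0 , k , refl
    go (suc f) _ (s≤s m≤f) | k , inj₂ refl with go f k (≤-trans (n≤double k) m≤f)
    ... | a , b , refl = suc a , b , refl

  pair-unpair : ∀ m → pair (proj₁ (unpair m)) (proj₂ (unpair m)) ≡ m
  pair-unpair m with pair-surjective m
  ... | a , b , refl = cong (λ p → pair (proj₁ p) (proj₂ p)) (unpair-pair a b)

  unpair-fst≤ : ∀ m → proj₁ (unpair m) ≤ m
  unpair-fst≤ m = ≤-trans (fst≤pair _ (proj₂ (unpair m))) (≤-reflexive (pair-unpair m))

  unpair-snd≤ : ∀ m → proj₂ (unpair m) ≤ m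
  unpair-snd≤ m = ≤-trans (snd≤pair (proj₁ (unpair m)) _) (≤-reflexive (pair-unpair m))

  pairᵖ : PrimRec {nat ⊗ nat} {nat} (λ x → pair (proj₁ x) (proj₂ x))
  pairᵖ = iterᵖ π₁ (doubleᵖ ⊙ π₂) (sucᵖ ⊙ doubleᵖ ⊙ π₂)

  -- The stripping is done on `m` instead of `m + 1`: an odd number `2k + 1` undoes one round of
  -- `pair`, an even one is where the rounds end. Even states are fixed, so surplus rounds do no
  -- harm and `suc m` of them suffice.
  unpairᵖ : PrimRec {nat} {nat ⊗ nat} unpair
  unpairᵖ = extᵖ (split ⊙ iterᵖ sucᵖ (zeroᵖ ▵ idᵖ)
                   (condᵖ (parᵖ ⊙ π₂ ⊙ π₂) π₂ (sucᵖ ⊙ π₁ ⊙ π₂ ▵ halfᵖ ⊙ π₂ ⊙ π₂))) correct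
    where
    split : PrimRec {nat ⊗ nat} {nat ⊗ nat} (λ x → proj₁ x , half (proj₂ x))
    split = π₁ ▵ halfᵖ ⊙ π₂
    step : ℕ × ℕ → ℕ × ℕ
    step (a , n) = cond (par n) (a , n) (suc a , half n)
    step-even : ∀ c b → step (c , double b) ≡ (c , double b)
    step-even c b rewrite par-double b = refl
    step-odd : ∀ c n → step (c , suc (double n)) ≡ (suc c , n)
    step-odd c n rewrite par-suc-double n | half-suc-double n = refl
    strip : ∀ k c a b → a ≤ k → iterate step k (c , pair a b) ≡ (a + c , double b)
    strip zero    c zero b _ = refl
    strip (suc k) c zero b _ = iterate-fixed step (step-even c b) (suc k)
    strip (suc k) c (suc a) b (s≤s a≤k) =
      ≡-trans (iterate-suc step k _) (≡-trans (cong (iterate step k) (step-odd c (pair a b)))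
        (≡-trans (strip k (suc c) a b a≤k) (cong (_, double b) (+-suc a c))))
    correct : ∀ m → (let r = iterate step (suc m) (0 , m) in proj₁ r , half (proj₂ r)) ≡ unpair m
    correct m with pair-surjective m
    ... | a , b , refl
      = ≡-trans (cong (λ r → proj₁ r , half (proj₂ r)) (strip (suc (pair a b)) 0 a b (m≤n⇒m≤1+n (fst≤pair a b))))
          (≡-trans (cong₂ _,_ (+-identityʳ a) (half-double b)) (≡-sym (unpair-pair a b)))

-- Lists coded by 0 and suc (pair head tail)

head tail : ℕ → ℕ
head l = proj₁ (unpair (pred l))
tail l = cond l 0 (proj₂ (unpair (pred l)))

cons : ℕ → ℕ → ℕ
cons a l = suc (pair a l)

head-cons : ∀ a l → head (cons a l) ≡ a
head-cons a l = cong proj₁ (unpair-pair a l)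

tail-cons : ∀ a l → tail (cons a l) ≡ l
tail-cons a l = cong proj₂ (unpair-pair a l)

headᵖ : PrimRec {nat} {nat} head
headᵖ = π₁ ⊙ unpairᵖ ⊙ predᵖ

tailᵖ : PrimRec {nat} {nat} tail
tailᵖ = condᵖ idᵖ zeroᵖ (π₂ ⊙ unpairᵖ ⊙ predᵖ)

consᵖ : PrimRec {nat ⊗ nat} {nat} (λ x → cons (proj₁ x) (proj₂ x))
consᵖ = sucᵖ ⊙ pairᵖ

-- Codes of programs

encodeInstr : Instr → ℕ
encodeInstr (inc k j)   = double (pair k j)
encodeInstr (dec k j l) = suc (double (pair k (pair j l)))

decodeInstr-even : ∀ a → isEven a ≡ true →
  decodeInstr a ≡ (let p = unpair (half a) in inc (proj₁ p) (proj₂ p))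
decodeInstr-even a eq rewrite eq = refl

decodeInstr-odd : ∀ a → isEven a ≡ false →
  decodeInstr a ≡ (let p = unpair (half a) ; q = unpair (proj₂ p) in dec (proj₁ p) (proj₁ q) (proj₂ q))
decodeInstr-odd a eq rewrite eq = refl

decodeInstr-encodeInstr : ∀ i → decodeInstr (encodeInstr i) ≡ i
decodeInstr-encodeInstr (inc k j) = go (double (pair k j)) (isEven-double (pair k j)) (half-double (pair k j))
  where
  go : ∀ a → isEven a ≡ true → half a ≡ pair k j → decodeInstr a ≡ inc k j
  go a even h = ≡-trans (decodeInstr-even a even)
    (cong (λ p → inc (proj₁ p) (proj₂ p)) (≡-trans (cong unpair h) (unpair-pair k j)))
decodeInstr-encodeInstr (dec k j l) = go (suc (double m)) (isEven-suc-double m) (half-suc-double m)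
  where
  m : ℕ
  m = pair k (pair j l)
  go : ∀ a → isEven a ≡ false → half a ≡ m → decodeInstr a ≡ dec k j l
  go a odd h = ≡-trans (decodeInstr-odd a odd)
    (≡-trans (cong (λ p → let q = unpair (proj₂ p) in dec (proj₁ p) (proj₁ q) (proj₂ q))
      (≡-trans (cong unpair h) (unpair-pair k (pair j l))))
      (cong (λ q → dec k (proj₁ q) (proj₂ q)) (unpair-pair j l)))

-- Adds n to register 1.  It is run once before the search, with register 3 equal to 0, and
-- once after it, with register 3 positive: since the code of the search must not depend on n,
-- only the loader can jump past the end of the program.
loader : ℕ → ℕ → Program
loader zero    j = dec 3 (suc j) 1 ∷ []
loader (suc n) j = inc 1 (suc j) ∷ loader n (suc j)

length-loader : ∀ n j → length (loader n j) ≡ suc n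
length-loader zero    j = refl
length-loader (suc n) j = cong suc (length-loader n (suc j))

encode : Program → ℕ
encode []      = 0
encode (i ∷ p) = cons (encodeInstr i) (encode p)

decodeList-encode : ∀ f p → encode p ≤ f → decodeList f (encode p) ≡ p
decodeList-encode zero    []      _ = refl
decodeList-encode (suc f) []      _ = refl
decodeList-encode (suc f) (i ∷ p) (s≤s le) =
  cong₂ _∷_
    (≡-trans (cong (λ q → decodeInstr (proj₁ q)) (unpair-pair (encodeInstr i) (encode p)))
      (decodeInstr-encodeInstr i))
    (≡-trans (cong (λ q → decodeList f (proj₂ q)) (unpair-pair (encodeInstr i) (encode p)))
      (decodeList-encode f p (≤-trans (snd≤pair (encodeInstr i) (encode p)) le)))

program-encode : ∀ p → program (encode p) ≡ p
program-encode p = decodeList-encode (encode p) p ≤-refl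

-- The prefix is fixed, so its instructions are consed on as constants, by a recursion outside the
-- function.
encode-++ᵖ : ∀ xs {l : ℕ → Program} → PrimRec {nat} {nat} (λ e → encode (l e)) →
             PrimRec {nat} {nat} (λ e → encode (xs ++ l e))
encode-++ᵖ []       L = L
encode-++ᵖ (i ∷ xs) L = consᵖ ⊙ (constᵖ (encodeInstr i) ▵ encode-++ᵖ xs L)

lastᵖ : PrimRec {nat} {nat} (λ q → encode (loader 0 q))
lastᵖ = consᵖ ⊙ (sucᵖ ⊙ doubleᵖ ⊙ pairᵖ ⊙ (constᵖ 3 ▵ pairᵖ ⊙ (sucᵖ ▵ constᵖ 1)) ▵ zeroᵖ)

-- Lists grow at the front, so the loader is built backwards from its final test: `j` is the address
-- where the code `l` begins, hence the jump target of the instruction placed at `pred j`.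
prepend : ℕ × ℕ → ℕ × ℕ
prepend (j , l) = pred j , cons (encodeInstr (inc 1 j)) l

prependᵖ : PrimRec {nat ⊗ nat} {nat ⊗ nat} prepend
prependᵖ = predᵖ ⊙ π₁ ▵ consᵖ ⊙ (doubleᵖ ⊙ pairᵖ ⊙ (constᵖ 1 ▵ π₁) ▵ π₂)

iterate-prepend : ∀ n m j →
  iterate prepend n (n + j , encode (loader m (n + j))) ≡ (j , encode (loader (n + m) j))
iterate-prepend zero    m j = refl
iterate-prepend (suc n) m j = cong prepend (≡-trans
  (cong (λ q → iterate prepend n (q , encode (loader m q))) (≡-sym (+-suc n j)))
  (iterate-prepend n m (suc j)))

loaderᵖ : ∀ u → PrimRec {nat} {nat} (λ e → encode (loader e u))
loaderᵖ u = extᵖ (π₂ ⊙ iterᵖ {nat} {nat ⊗ nat} idᵖ (end ▵ lastᵖ ⊙ end) (prependᵖ ⊙ π₂))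
  λ e → ≡-trans (cong proj₂ (iterate-prepend e 0 u)) (cong (λ n → encode (loader n u)) (+-identityʳ e))
  where
  end : PrimRec {nat} {nat} (λ e → e + u)
  end = addᵖ ⊙ (idᵖ ▵ constᵖ u)

primRec-computable : ∀ {h} → PrimRec {nat} {nat} h → Computable h
primRec-computable {h} H = encode p , compute
  where
  c : Cmd
  -- Input and output share register 0, whereas compiled code needs them disjoint; the result is
  -- computed in register 1 and copied.
  c = compile (fn H) 0 1 2 ⨾ copy 1 0 2
  p : Program
  p = assemble c 0
  end : nth p (size c + 0) ≡ nothing
  end = ≡-trans (cong (nth p) (≡-trans (+-identityʳ (size c)) (≡-sym (length-assemble c 0)))) (nth-length p)
  compute : ∀ x → encode p ⟨ x ⟩↓ h x
  compute x
    with compile-transfers (fn H) 0 1 2 x (λ { j refl → s≤s z≤n }) (λ { j refl → ≤-refl }) tt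
           (λ { j refl () }) (initRegs x) refl
  ... | r₁ , x₁ , e₁ , _
    with copy-spec 1 0 2 r₁ (λ ()) (λ ()) (λ ())
  ... | r₂ , x₂ , e₂ , _
    with assemble-sound {p = p} 0 (seq⇓ x₁ x₂) (codeAt-suffix [] p)
  -- The extra unit of fuel pays for the round in which `run` finds no instruction.
  ... | k , steps = k + 1 , r₂ ,
    ≡-trans (cong (λ q → run (k + 1) q 0 (initRegs x)) (program-encode p))
      (≡-trans (steps 1) (run-halt {p} {size c + 0} r₂ 0 end)) ,
    ≡-trans e₂ (≡-trans e₁ (sound H x))

-- Unbounded search

module Search (F : Fn (nat ⊗ nat ⊗ nat) nat) where

  body : Cmd
  body = compile F (0 , 1 , 2) 3 4

  start : ℕ
  start = 4 + size body

  -- Registers 0, 1 and 2 hold `x`, `e` and the stage, register 3 the value of `F`. If that value is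
  -- zero, the second instruction advances the stage and restarts the body; otherwise the third
  -- makes register 3 positive again and enters the loader, whose final test then leaves the
  -- program.
  test : Program
  test = dec 3 (3 + size body) (2 + size body) ∷ inc 2 1 ∷ inc 3 start ∷ []

  search : Program
  -- Register 1 is zero at the outset, so this is a plain jump to the loader.
  search = dec 1 start start ∷ assemble body 1 ++ test

  machine : ℕ → Program
  machine e = search ++ loader e start

  length-search : length search ≡ start
  length-search = cong suc (≡-trans (length-++ (assemble body 1))
    (≡-trans (cong (_+ 3) (length-assemble body 1)) (+-comm (size body) 3)))

  module _ (x e : ℕ) where

    P : Program
    P = machine e

    at-start : CodeAt P 0 search × CodeAt P start (loader e start)
    at-start with codeAt-++ search (codeAt-suffix [] P)
    ... | s , l = s , subst (λ n → CodeAt P n (loader e start)) (≡-trans (+-identityʳ _) length-search) l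

    at-body : CodeAt P 1 (assemble body 1)
    at-body = proj₁ (codeAt-++ (assemble body 1) (proj₂ (proj₁ at-start)))

    at-test : CodeAt P (suc (size body)) test
    at-test = subst (λ n → CodeAt P n test)
      (≡-trans (cong (_+ 1) (length-assemble body 1)) (+-comm (size body) 1))
      (proj₂ (codeAt-++ (assemble body 1) (proj₂ (proj₁ at-start))))

    past-end : nth P (suc (e + start)) ≡ nothing
    past-end = ≡-trans (cong (nth P) (≡-sym (≡-trans (length-++ search)
      (≡-trans (cong₂ _+_ length-search (length-loader e start)) (+-comm start (suc e)))))) (nth-length P)

    loader-spec : ∀ n j r → CodeAt P j (loader n j) →
      ∃ λ r' → Reach P j r (n + j) r' × nth P (n + j) ≡ just (dec 3 (suc (n + j)) 1)
               × r' 1 ≡ n + r 1 × (∀ i → i ≢ 1 → r' i ≡ r i)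
    loader-spec zero    j r (eq , _)  = r , reach-refl , eq , refl , λ _ _ → refl
    loader-spec (suc n) j r (eq , at) with loader-spec n (suc j) (set r 1 (suc (r 1))) at
    ... | r' , reach , last , one , other = r' ,
      subst (λ q → Reach P j r q r') (+-suc n j) (reach-trans (reach-inc r eq) reach) ,
      subst (λ q → nth P q ≡ just (dec 3 (suc q) 1)) (+-suc n j) last ,
      ≡-trans one (≡-trans (cong (n +_) (set-same r 1 _)) (+-suc n (r 1))) ,
      λ i i≢1 → ≡-trans (other i i≢1) (set-other r 1 _ i≢1)

    State : ℕ → Regs → Set
    State t r = Holds (nat ⊗ nat ⊗ nat) r (0 , 1 , 2) (x , e , t)

    initialise : ∃ λ r → Reach P 0 (initRegs x) 1 r × State 0 r
    initialise with loader-spec e start (initRegs x) (proj₂ at-start)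
    ... | r , reach , last , one , other = r ,
      reach-trans (reach-zero (initRegs x) (proj₁ (proj₁ at-start)) refl)
        (reach-trans reach (reach-zero r last (other 3 (λ ())))) ,
      (other 0 (λ ()) , ≡-trans one (+-identityʳ e) , other 2 (λ ()))

    run-body : ∀ t r → State t r → ∃ λ r' → Reach P 1 r (suc (size body)) r' × State t r' × r' 3 ≡ eval F (x , e , t)
    run-body t r st
      with compile-transfers F (0 , 1 , 2) 3 4 (x , e , t)
             (λ { j (inj₁ refl) → s≤s z≤n
                ; j (inj₂ (inj₁ refl)) → s≤s (s≤s z≤n)
                ; j (inj₂ (inj₂ refl)) → s≤s (s≤s (s≤s z≤n)) })
             (λ { j refl → ≤-refl }) tt
             (λ { j (inj₁ refl) () ; j (inj₂ (inj₁ refl)) () ; j (inj₂ (inj₂ refl)) () })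
             r st
    ... | r' , ev , result , frame = r' ,
      subst (λ n → Reach P 1 r n r') (+-comm (size body) 1) (assemble-sound 1 ev at-body) ,
      (≡-trans (frame 0 (s≤s z≤n) (λ ())) (proj₁ st) ,
       ≡-trans (frame 1 (s≤s (s≤s z≤n)) (λ ())) (proj₁ (proj₂ st)) ,
       ≡-trans (frame 2 (s≤s (s≤s (s≤s z≤n))) (λ ())) (proj₂ (proj₂ st))) ,
      result

    -- The number of steps is a successor because `search-sound` recurses on the fuel, of which
    -- every failed stage must consume some.
    continue : ∀ t r → State t r → eval F (x , e , t) ≡ 0 →
               ∃₂ λ k r' → Steps (suc k) P 1 r 1 r' × State (suc t) r'
    continue t r st z with run-body t r st
    ... | r₁ , (k , reach) , (s₀ , s₁ , s₂) , s₃ = k + 1 , r₂ ,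
      subst (λ n → Steps n P 1 r 1 r₂) (+-suc k 1)
        (proj₂ (reach-trans (k , reach)
          (reach-trans (reach-zero r₁ (proj₁ at-test) (≡-trans s₃ z))
                       (reach-inc r₁ (proj₁ (proj₂ at-test)))))) ,
      (≡-trans (set-other r₁ 2 (suc (r₁ 2)) (λ ())) s₀ , ≡-trans (set-other r₁ 2 (suc (r₁ 2)) (λ ())) s₁ ,
       ≡-trans (set-same r₁ 2 _) (cong suc s₂))
      where
      r₂ : Regs
      r₂ = set r₁ 2 (suc (r₁ 2))

    stop : ∀ t r v → State t r → eval F (x , e , t) ≡ suc v → ∃₂ λ k r' → run k P 1 r ≡ just r'
    stop t r v st nz with run-body t r st
    ... | r₁ , reach₁ , _ , s₃ with loader-spec e start r₃ (proj₂ at-start)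
      where
      r₂ r₃ : Regs
      r₂ = set r₁ 3 v
      r₃ = set r₂ 3 (suc (r₂ 3))
    ... | r₄ , reach₄ , last , _ , other =
      let (k , steps) = reach-trans reach₁ (reach-trans
            (reach-trans (reach-suc r₁ (proj₁ at-test) (≡-trans s₃ nz))
                         (reach-inc (set r₁ 3 v) (proj₁ (proj₂ (proj₂ at-test)))))
            (reach-trans reach₄
              (reach-suc r₄ last (≡-trans (other 3 (λ ())) (set-same (set r₁ 3 v) 3 _)))))
      in k + 1 , set r₄ 3 (set r₁ 3 v 3) , ≡-trans (steps 1) (run-halt {P} {suc (e + start)} (set r₄ 3 (set r₁ 3 v 3)) 0 past-end)

    -- `d` is the distance to a stage known to succeed; the search may well stop earlier.
    search-complete : ∀ d t r → State t r → eval F (x , e , d + t) ≢ 0 → ∃₂ λ k r' → run k P 1 r ≡ just r'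
    search-complete d t r st nz with eval F (x , e , t) in eq
    ... | suc v = stop t r v st eq
    search-complete zero    t r st nz | zero = ⊥-elim (nz eq)
    search-complete (suc d) t r st nz | zero with continue t r st eq
    ... | k , r' , steps , st'
      with search-complete d (suc t) r' st' (λ z → nz (≡-trans (cong (λ n → eval F (x , e , n)) (≡-sym (+-suc d t))) z))
    ... | k' , r'' , halts = suc k + k' , r'' , ≡-trans (steps k') halts

    search-sound : ∀ G g t r {r'} → g ≤ G → State t r → run g P 1 r ≡ just r' → ∃ λ t' → eval F (x , e , t') ≢ 0
    search-sound G g t r g≤G st halts with eval F (x , e , t) in eq
    ... | suc v = t , λ z → 1+n≢0 (≡-trans (≡-sym eq) z)
    ... | zero with continue t r st eq
    ... | k , r' , steps , st' with steps-back (suc k) steps g halts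
    search-sound (suc G) _ t r (s≤s le) st halts | zero | k , r' , steps , st' | g' , refl , halts' =
      search-sound G g' (suc t) r' (≤-trans (m≤n+m g' k) le) st' halts'

    machine-halts : ∀ t → eval F (x , e , t) ≢ 0 → x ∈W encode P
    machine-halts t nz with initialise
    ... | r , (k , steps) , st with search-complete t 0 r st (λ z → nz (≡-trans (cong (λ n → eval F (x , e , n)) (≡-sym (+-identityʳ t))) z))
    ... | k' , r' , halts = r' 0 , k + k' , r' ,
      ≡-trans (cong (λ p → run (k + k') p 0 (initRegs x)) (program-encode P)) (≡-trans (steps k') halts) , refl

    machine-halted : x ∈W encode P → ∃ λ t → eval F (x , e , t) ≢ 0
    machine-halted (_ , g , r' , halts , _) with initialise
    ... | r , (k , steps) , st
      with steps-back k steps g (≡-trans (cong (λ p → run g p 0 (initRegs x)) (≡-sym (program-encode P))) halts)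
    ... | g' , _ , halts' = search-sound g' g' 0 r ≤-refl st halts'

opaque
  -- Only the loader depends on `e`, so the code of `machine e` is primitive recursive in `e`.
  enumerate : ∀ {f} → PrimRec {nat ⊗ nat ⊗ nat} {nat} f →
    ∃ λ h → Computable h × (∀ e x → (x ∈W h e → ∃ λ t → f (x , e , t) ≢ 0) × (∀ t → f (x , e , t) ≢ 0 → x ∈W h e))
  enumerate {f} F = (λ e → encode (machine e)) , primRec-computable (encode-++ᵖ search (loaderᵖ start)) , λ e x →
    (λ x∈W → let (t , nz) = machine-halted x e x∈W in t , λ z → nz (≡-trans (sound F _) z)) ,
    λ t nz → machine-halts x e t (λ z → nz (≡-trans (≡-sym (sound F _)) z))
    where open Search (fn F)

-- Coded computations

drop : ℕ → ℕ → ℕ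
drop l n = iterate tail n l

dropᵖ : PrimRec {nat ⊗ nat} {nat} (λ x → drop (proj₁ x) (proj₂ x))
dropᵖ = iterᵖ π₂ π₁ (tailᵖ ⊙ π₂)

fetch : ℕ → Maybe Instr
fetch zero    = nothing
fetch (suc m) = just (decodeInstr (proj₁ (unpair m)))

-- Because `tail 0` is 0, running off the end of the list yields the code 0, which `fetch` maps to
-- `nothing`.
nth-decodeList : ∀ f m pc → m ≤ f → nth (decodeList f m) pc ≡ fetch (drop m pc)
nth-decodeList zero    zero    pc       _         = cong fetch (≡-sym (iterate-fixed tail refl pc))
nth-decodeList (suc f) zero    pc       _         = cong fetch (≡-sym (iterate-fixed tail refl pc))
nth-decodeList (suc f) (suc m) zero     _         = refl
nth-decodeList (suc f) (suc m) (suc pc) (s≤s m≤f) =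
  ≡-trans (nth-decodeList f (proj₂ (unpair m)) pc (≤-trans (unpair-snd≤ m) m≤f))
    (cong fetch (≡-sym (iterate-suc tail pc (suc m))))

-- Register contents are coded by the list of all assignments (register , value), newest first.

store : ℕ → ℕ → ℕ → ℕ
store k v R = cons (pair k v) R

scan : ℕ → ℕ → ℕ
scan k R = cond (dist k (proj₁ (unpair (head R)))) R (tail R)

-- A list is no longer than its code, so `R` rounds of `scan` are enough. A register without an
-- assignment reads as 0, since `unpair 0` is `(0 , 0)`; this gives the initial contents of the
-- machine.
look : ℕ → ℕ → ℕ
look R k = proj₂ (unpair (head (iterate (scan k) R R)))

storeᵖ : PrimRec {nat ⊗ nat ⊗ nat} {nat} (λ x → store (proj₁ x) (proj₁ (proj₂ x)) (proj₂ (proj₂ x)))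
storeᵖ = consᵖ ⊙ (pairᵖ ⊙ (π₁ ▵ π₁ ⊙ π₂) ▵ π₂ ⊙ π₂)

scanᵖ : PrimRec {nat ⊗ nat} {nat} (λ x → scan (proj₁ x) (proj₂ x))
scanᵖ = condᵖ (distᵖ ⊙ (π₁ ▵ π₁ ⊙ unpairᵖ ⊙ headᵖ ⊙ π₂)) π₂ (tailᵖ ⊙ π₂)

lookᵖ : PrimRec {nat ⊗ nat} {nat} (λ x → look (proj₁ x) (proj₂ x))
lookᵖ = π₂ ⊙ unpairᵖ ⊙ headᵖ ⊙ iterᵖ π₁ π₁ (scanᵖ ⊙ (π₂ ⊙ π₁ ▵ π₂))

scan-zero : ∀ k → scan k 0 ≡ 0
scan-zero k with dist k 0
... | zero  = refl
... | suc _ = refl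

scan-hit : ∀ k v R → scan k (store k v R) ≡ store k v R
scan-hit k v R = cong (λ d → cond d (store k v R) (tail (store k v R)))
  (≡-trans (cong (λ q → dist k (proj₁ (unpair q))) (head-cons (pair k v) R))
    (≡-trans (cong (λ q → dist k (proj₁ q)) (unpair-pair k v)) (dist-self k)))

scan-miss : ∀ {k k'} v R → k' ≢ k → scan k' (store k v R) ≡ R
scan-miss {k} {k'} v R k'≢k =
  ≡-trans (cong (λ q → cond (dist k' (proj₁ (unpair q))) (store k v R) (tail (store k v R))) (head-cons (pair k v) R))
    (≡-trans (cong (λ q → cond (dist k' (proj₁ q)) (store k v R) (tail (store k v R))) (unpair-pair k v))
      (skip-head (dist k' k) refl))
  where
  skip-head : ∀ d → dist k' k ≡ d → cond d (store k v R) (tail (store k v R)) ≡ R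
  skip-head zero    eq = ⊥-elim (k'≢k (dist-zero k' k eq))
  skip-head (suc _) _  = tail-cons (pair k v) R

-- A round either has arrived or passes to the tail, whose code is smaller. The independence from
-- the number of rounds is needed because `store` enlarges the code and with it the number of rounds
-- made by `look`.
scan-stable : ∀ k f R n m → R ≤ f → R ≤ n → R ≤ m → iterate (scan k) n R ≡ iterate (scan k) m R
scan-stable k f zero n m _ _ _ =
  ≡-trans (iterate-fixed (scan k) (scan-zero k) n) (≡-sym (iterate-fixed (scan k) (scan-zero k) m))
scan-stable k (suc f) (suc R) (suc n) (suc m) (s≤s R≤f) (s≤s R≤n) (s≤s R≤m)
  with dist k (proj₁ (unpair (head (suc R)))) in eq
... | zero = ≡-trans (iterate-fixed (scan k) stays (suc n)) (≡-sym (iterate-fixed (scan k) stays (suc m)))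
  where
  stays : scan k (suc R) ≡ suc R
  stays = cong (λ d → cond d (suc R) (tail (suc R))) eq
... | suc d = ≡-trans (moves n) (≡-trans
    (scan-stable k f (proj₂ (unpair R)) n m (≤-trans (unpair-snd≤ R) R≤f)
      (≤-trans (unpair-snd≤ R) R≤n) (≤-trans (unpair-snd≤ R) R≤m))
    (≡-sym (moves m)))
  where
  moves : ∀ n → iterate (scan k) (suc n) (suc R) ≡ iterate (scan k) n (proj₂ (unpair R))
  moves n = ≡-trans (iterate-suc (scan k) n (suc R))
    (cong (iterate (scan k) n) (cong (λ d → cond d (suc R) (tail (suc R))) eq))

look-store-same : ∀ k v R → look (store k v R) k ≡ v
look-store-same k v R =
  ≡-trans (cong (λ q → proj₂ (unpair (head q))) (iterate-fixed (scan k) (scan-hit k v R) (store k v R)))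
    (≡-trans (cong (λ q → proj₂ (unpair q)) (head-cons (pair k v) R)) (cong proj₂ (unpair-pair k v)))

look-store-other : ∀ {k k'} v R → k' ≢ k → look (store k v R) k' ≡ look R k'
look-store-other {k} {k'} v R k'≢k = cong (λ q → proj₂ (unpair (head q)))
  (≡-trans (iterate-suc (scan k') (pair (pair k v) R) (store k v R))
    (≡-trans (cong (iterate (scan k') (pair (pair k v) R)) (scan-miss v R k'≢k))
      (scan-stable k' R R (pair (pair k v) R) R ≤-refl (snd≤pair (pair k v) R) ≤-refl)))

Represents : ℕ → Regs → Set
Represents R r = ∀ k → look R k ≡ r k

represents-store : ∀ {R r} k {v v'} → v ≡ v' → Represents R r → Represents (store k v R) (set r k v')
represents-store {R} {r} k {v} refl rep n with n ≟ k
... | yes refl = look-store-same k v R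
... | no n≢k   = ≡-trans (look-store-other v R n≢k) (rep n)

after : Instr → Regs → ℕ × Regs
after (inc k j)   r = j , set r k (suc (r k))
after (dec k j l) r = cond (r k) (l , r) (j , set r k (pred (r k)))

run-after : ∀ {p pc i} f r → nth p pc ≡ just i →
            run (suc f) p pc r ≡ run f p (proj₁ (after i r)) (proj₂ (after i r))
run-after {i = inc k j}   f r eq rewrite eq = refl
run-after {i = dec k j l} f r eq rewrite eq with r k
... | zero  = refl
... | suc v = refl

even-odd : ∀ i → isEven i ≡ true × par i ≡ 0 ⊎ isEven i ≡ false × par i ≡ 1
even-odd zero          = inj₁ (refl , refl)
even-odd (suc zero)    = inj₂ (refl , refl)
even-odd (suc (suc i)) = even-odd i

Simulates : ℕ × ℕ → ℕ × Regs → Set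
Simulates (pc , R) (pc' , r) = pc ≡ pc' × Represents R r

increment : ℕ → ℕ → ℕ → ℕ × ℕ
increment k j R = j , store k (suc (look R k)) R

decrement : ℕ → ℕ → ℕ → ℕ → ℕ × ℕ
decrement k j l R = cond (look R k) (l , R) (j , store k (pred (look R k)) R)

increment-simulates : ∀ k j {R r} → Represents R r → Simulates (increment k j R) (after (inc k j) r)
increment-simulates k j {R} {r} rep = refl , represents-store {R} {r} k (cong suc (rep k)) rep

decrement-simulates : ∀ k j l {R r} → Represents R r → Simulates (decrement k j l R) (after (dec k j l) r)
decrement-simulates k j l {R} {r} rep rewrite rep k with r k
... | zero  = refl , rep
... | suc v = refl , represents-store {R} {r} k refl rep

opaque
  execute : ℕ → ℕ → ℕ × ℕ
  execute i R =
    let u = unpair (half i)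
        w = unpair (proj₂ u)
    in cond (par i) (increment (proj₁ u) (proj₂ u) R) (decrement (proj₁ u) (proj₁ w) (proj₂ w) R)

  executeᵖ : PrimRec {nat ⊗ nat} {nat ⊗ nat} (λ x → execute (proj₁ x) (proj₂ x))
  executeᵖ = condᵖ (parᵖ ⊙ π₁) (incrementᵖ ⊙ (π₁ ⊙ u ▵ π₂ ⊙ u ▵ π₂))
               (decrementᵖ ⊙ (π₁ ⊙ u ▵ π₁ ⊙ w ▵ π₂ ⊙ w ▵ π₂))
    where
    incrementᵖ : PrimRec {nat ⊗ nat ⊗ nat} {nat ⊗ nat} (λ (k , j , R) → increment k j R)
    incrementᵖ = π₁ ⊙ π₂ ▵ storeᵖ ⊙ (π₁ ▵ sucᵖ ⊙ lookᵖ ⊙ (π₂ ⊙ π₂ ▵ π₁) ▵ π₂ ⊙ π₂)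
    decrementᵖ : PrimRec {nat ⊗ nat ⊗ nat ⊗ nat} {nat ⊗ nat} (λ (k , j , l , R) → decrement k j l R)
    decrementᵖ = condᵖ v (π₁ ⊙ π₂ ⊙ π₂ ▵ R) (π₁ ⊙ π₂ ▵ storeᵖ ⊙ (π₁ ▵ predᵖ ⊙ v ▵ R))
      where
      R : PrimRec {nat ⊗ nat ⊗ nat ⊗ nat} {nat} (λ x → proj₂ (proj₂ (proj₂ x)))
      R = π₂ ⊙ π₂ ⊙ π₂
      v : PrimRec {nat ⊗ nat ⊗ nat ⊗ nat} {nat} (λ x → look (proj₂ (proj₂ (proj₂ x))) (proj₁ x))
      v = lookᵖ ⊙ (R ▵ π₁)
    u : PrimRec {nat ⊗ nat} {nat ⊗ nat} (λ x → unpair (half (proj₁ x)))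
    u = unpairᵖ ⊙ halfᵖ ⊙ π₁
    w : PrimRec {nat ⊗ nat} {nat ⊗ nat} (λ x → unpair (proj₂ (unpair (half (proj₁ x)))))
    w = unpairᵖ ⊙ π₂ ⊙ u

  execute-simulates : ∀ i {R r} → Represents R r → Simulates (execute i R) (after (decodeInstr i) r)
  execute-simulates i {R} {r} rep with even-odd i
  ... | inj₁ (even , p) = subst₂ Simulates
    (cong (λ q → cond q (increment k j R) (decrement k (proj₁ (unpair j)) (proj₂ (unpair j)) R)) (≡-sym p))
    (cong (λ i → after i r) (≡-sym (decodeInstr-even i even)))
    (increment-simulates k j {R} {r} rep)
    where
    k j : ℕ
    k = proj₁ (unpair (half i))
    j = proj₂ (unpair (half i))
  ... | inj₂ (odd , p) = subst₂ Simulates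
    (cong (λ q → cond q (increment k m R) (decrement k (proj₁ (unpair m)) (proj₂ (unpair m)) R)) (≡-sym p))
    (cong (λ i → after i r) (≡-sym (decodeInstr-odd i odd)))
    (decrement-simulates k (proj₁ (unpair m)) (proj₂ (unpair m)) {R} {r} rep)
    where
    k m : ℕ
    k = proj₁ (unpair (half i))
    m = proj₂ (unpair (half i))

step : ℕ → ℕ × ℕ → ℕ × ℕ
step e (pc , R) = cond (drop e pc) (pc , R) (execute (head (drop e pc)) R)

stepᵖ : PrimRec {nat ⊗ nat ⊗ nat} {nat ⊗ nat} (λ x → step (proj₁ x) (proj₂ x))
stepᵖ = condᵖ d π₂ (executeᵖ ⊙ (headᵖ ⊙ d ▵ π₂ ⊙ π₂))
  where
  d : PrimRec {nat ⊗ nat ⊗ nat} {nat} (λ x → drop (proj₁ x) (proj₁ (proj₂ x)))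
  d = dropᵖ ⊙ (π₁ ▵ π₁ ⊙ π₂)

Halted : ℕ → ℕ × ℕ → Set
Halted e c = drop e (proj₁ c) ≡ 0

Progress : ℕ → ℕ → Set
Progress e pc = nth (program e) pc ≡ nothing × drop e pc ≡ 0 ⊎
  (∃ λ i → nth (program e) pc ≡ just i × drop e pc ≢ 0
           × (∀ {R r} → Represents R r → Simulates (step e (pc , R)) (after i r)))

halted-or-steps : ∀ e pc → Progress e pc
halted-or-steps e pc = go (drop e pc) refl
  where
  go : ∀ d → drop e pc ≡ d → Progress e pc
  go zero    eq = inj₁ (≡-trans (nth-decodeList e e pc ≤-refl) (cong fetch eq) , eq)
  go (suc m) eq = inj₂ (_ , ≡-trans (nth-decodeList e e pc ≤-refl) (cong fetch eq) ,
    (λ z → 1+n≢0 (≡-trans (≡-sym eq) z)) ,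
    λ {R} {r} rep → subst (λ c → Simulates c (after (decodeInstr (proj₁ (unpair m))) r))
      (cong (λ d → cond d (pc , R) (execute (head d) R)) (≡-sym eq))
      (execute-simulates (proj₁ (unpair m)) {R} {r} rep))

simulation-halts : ∀ e f pc R r {s} → Represents R r → run f (program e) pc r ≡ just s →
                   ∃ λ t → Halted e (iterate (step e) t (pc , R))
simulation-halts e (suc f) pc R r rep halts with halted-or-steps e pc
... | inj₁ (_ , d) = 0 , d
... | inj₂ (i , at , _ , sim) = next (step e (pc , R)) refl (sim {R} {r} rep)
  where
  next : ∀ c → step e (pc , R) ≡ c → Simulates c (after i r) → ∃ λ t → Halted e (iterate (step e) t (pc , R))
  next (_ , R') eq (refl , rep')
    with simulation-halts e f _ R' _ rep' (≡-trans (≡-sym (run-after f r at)) halts)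
  ... | t , d = suc t , subst (Halted e)
    (≡-sym (≡-trans (iterate-suc (step e) t (pc , R)) (cong (iterate (step e) t) eq))) d

simulated-halts : ∀ e t pc R r → Represents R r → Halted e (iterate (step e) t (pc , R)) →
                  ∃₂ λ f s → run f (program e) pc r ≡ just s
simulated-halts e t pc R r rep h with halted-or-steps e pc
... | inj₁ (out , _) = 1 , r , run-halt {program e} {pc} r 0 out
simulated-halts e zero    pc R r rep h | inj₂ (_ , _ , d , _) = ⊥-elim (d h)
simulated-halts e (suc t) pc R r rep h | inj₂ (i , at , _ , sim) = next (step e (pc , R)) refl (sim {R} {r} rep)
  where
  next : ∀ c → step e (pc , R) ≡ c → Simulates c (after i r) → ∃₂ λ f s → run f (program e) pc r ≡ just s
  next (_ , R') eq (refl , rep')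
    with simulated-halts e t _ R' _ rep'
           (subst (Halted e) (≡-trans (iterate-suc (step e) t (pc , R)) (cong (iterate (step e) t) eq)) h)
  ... | f , s , halts = suc f , s , ≡-trans (run-after f r at) halts

represents-init : ∀ x → Represents (store 0 x 0) (initRegs x)
represents-init x zero    = look-store-same 0 x 0
represents-init x (suc k) = look-store-other x 0 (λ ())

opaque
  -- A form of Kleene's T predicate, with the number of simulated steps as the witness.
  haltsBy : ℕ → ℕ → ℕ → ℕ
  haltsBy x e t = cond (drop e (proj₁ (iterate (step e) t (0 , store 0 x 0)))) 1 0

  haltsByᵖ : PrimRec {nat ⊗ nat ⊗ nat} {nat} (λ x → haltsBy (proj₁ x) (proj₁ (proj₂ x)) (proj₂ (proj₂ x)))
  haltsByᵖ = condᵖ (dropᵖ ⊙ (π₁ ⊙ π₂ ▵ π₁ ⊙ iterᵖ {nat ⊗ nat ⊗ nat} {nat ⊗ nat} (π₂ ⊙ π₂)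
      (zeroᵖ ▵ storeᵖ ⊙ (zeroᵖ ▵ π₁ ▵ zeroᵖ)) (stepᵖ ⊙ (π₁ ⊙ π₂ ⊙ π₁ ▵ π₂))))
    (constᵖ 1) zeroᵖ

  ∈W⇒haltsBy : ∀ {x e} → x ∈W e → ∃ λ t → haltsBy x e t ≢ 0
  ∈W⇒haltsBy {x} {e} (_ , f , r , halts , _)
    with simulation-halts e f 0 (store 0 x 0) (initRegs x) (represents-init x) halts
  ... | t , d = t , λ z → 1+n≢0 (≡-trans (≡-sym (cong (λ n → cond n 1 0) d)) z)

  haltsBy⇒∈W : ∀ {x e} t → haltsBy x e t ≢ 0 → x ∈W e
  haltsBy⇒∈W {x} {e} t nz
    with simulated-halts e t 0 (store 0 x 0) (initRegs x) (represents-init x) (cond-zero _ nz)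
    where
    cond-zero : ∀ n → cond n 1 0 ≢ 0 → n ≡ 0
    cond-zero zero    _  = refl
    cond-zero (suc n) nz = ⊥-elim (nz refl)
  ... | f , r , halts = r 0 , f , r , halts , refl

-- Lengths of terms

-- The exponent of the power of `x₀` to which the monoid laws reduce the term.
len : Term → ℕ
len x₀      = 1
len ε       = 0
len (s · t) = len s + len t

iterate-+ : ∀ {A : Set} (f : A → A) m n a → iterate f (m + n) a ≡ iterate f m (iterate f n a)
iterate-+ f zero    n a = refl
iterate-+ f (suc m) n a = cong f (iterate-+ f m n a)

-- A traversal keeps the list of the codes still to be visited and the length found so far.

visit : ℕ → ℕ → ℕ → ℕ × ℕ
visit c S n =
  let q = unpair (pred (pred c))
  in cond c (S , suc n) (cond (pred c) (S , n) (cons (proj₁ q) (cons (proj₂ q) S) , n))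

advance : ℕ × ℕ → ℕ × ℕ
advance (S , n) = cond S (S , n) (visit (head S) (tail S) n)

codeLen : ℕ → ℕ
codeLen c = proj₂ (iterate advance (suc c) (cons c 0 , 0))

codeLenᵖ : PrimRec {nat} {nat} codeLen
codeLenᵖ = π₂ ⊙ iterᵖ {nat} {nat ⊗ nat} sucᵖ (consᵖ ⊙ (idᵖ ▵ zeroᵖ) ▵ zeroᵖ) (advanceᵖ ⊙ π₂)
  where
  visitᵖ : PrimRec {nat ⊗ nat ⊗ nat} {nat ⊗ nat} (λ x → visit (proj₁ x) (proj₁ (proj₂ x)) (proj₂ (proj₂ x)))
  visitᵖ = condᵖ π₁ (π₁ ⊙ π₂ ▵ sucᵖ ⊙ π₂ ⊙ π₂) (condᵖ (predᵖ ⊙ π₁) π₂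
    (consᵖ ⊙ (π₁ ⊙ q ▵ consᵖ ⊙ (π₂ ⊙ q ▵ π₁ ⊙ π₂)) ▵ π₂ ⊙ π₂))
    where
    q : PrimRec {nat ⊗ nat ⊗ nat} {nat ⊗ nat} (λ x → unpair (pred (pred (proj₁ x))))
    q = unpairᵖ ⊙ predᵖ ⊙ predᵖ ⊙ π₁
  advanceᵖ : PrimRec {nat ⊗ nat} {nat ⊗ nat} advance
  advanceᵖ = condᵖ π₁ idᵖ (visitᵖ ⊙ (headᵖ ⊙ π₁ ▵ tailᵖ ⊙ π₁ ▵ π₂))

advance-cons : ∀ c S n → advance (cons c S , n) ≡ visit c S n
advance-cons c S n = cong₂ (λ a b → visit a b n) (head-cons c S) (tail-cons c S)

-- A product with factors coded by `a` and `b` takes one round and at most `(a + 1) + (b + 1)` more;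
-- since `a + b ≤ pair a b`, the total stays within `suc c`. Surplus rounds idle on the empty stack,
-- so `codeLen` can make exactly `suc c` of them.
traverse : ∀ f c → c ≤ f → ∃ λ k → k ≤ suc c ×
  (∀ S n → iterate advance k (cons c S , n) ≡ (S , len (decodeTermF f c) + n))
traverse f zero       _ = 1 , ≤-refl , advance-cons 0
traverse f (suc zero) _ = 1 , s≤s z≤n , advance-cons 1
traverse (suc f) (suc (suc m)) (s≤s m<f)
  with traverse f (proj₁ (unpair m)) (≤-trans (unpair-fst≤ m) (<⇒≤ m<f))
     | traverse f (proj₂ (unpair m)) (≤-trans (unpair-snd≤ m) (<⇒≤ m<f))
... | i , i≤ , visit-a | j , j≤ , visit-b = j + (i + 1) , bound , visits
  where
  a b : ℕ
  a = proj₁ (unpair m)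
  b = proj₂ (unpair m)
  A B : Term
  A = decodeTermF f a
  B = decodeTermF f b
  a+b≤m : a + b ≤ m
  a+b≤m = ≤-trans (+≤pair a b) (≤-reflexive (pair-unpair m))
  bound : j + (i + 1) ≤ suc (suc (suc m))
  bound = ≤-trans (+-mono-≤ j≤ (+-monoˡ-≤ 1 i≤))
    (≤-trans (≤-reflexive (≡-trans (cong (λ n → suc (b + n)) (+-comm (suc a) 1))
                            (cong suc (≡-trans (+-comm b (suc (suc a))) refl))))
      (s≤s (s≤s (s≤s a+b≤m))))
  visits : ∀ S n → iterate advance (j + (i + 1)) (cons (suc (suc m)) S , n) ≡ (S , (len A + len B) + n)
  visits S n =
    ≡-trans (iterate-+ advance j (i + 1) (cons (suc (suc m)) S , n))
      (≡-trans (cong (iterate advance j)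
        (≡-trans (iterate-+ advance i 1 (cons (suc (suc m)) S , n))
          (≡-trans (cong (iterate advance i) (advance-cons (suc (suc m)) S n)) (visit-a (cons b S) n))))
      (≡-trans (visit-b S (len A + n))
        (cong (S ,_) (≡-trans (≡-sym (+-assoc (len B) (len A) n)) (cong (_+ n) (+-comm (len B) (len A)))))))

codeLen-correct : ∀ c → codeLen c ≡ len (decodeTerm c)
codeLen-correct c with traverse c c ≤-refl
... | k , k≤ , visits = cong proj₂
  (≡-trans (cong (λ n → iterate advance n (cons c 0 , 0)) (≡-sym (m∸n+n≡m k≤)))
    (≡-trans (iterate-+ advance (suc c ∸ k) k (cons c 0 , 0))
      (≡-trans (cong (iterate advance (suc c ∸ k)) (visits 0 0))
        (≡-trans (iterate-fixed advance refl (suc c ∸ k)) (cong (0 ,_) (+-identityʳ _))))))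

lhs rhs : ℕ → ℕ
lhs n = codeLen (proj₁ (unpair n))
rhs n = codeLen (proj₂ (unpair n))

lhs-correct : ∀ {n s t} → decodePair n ≡ (s , t) → lhs n ≡ len s
lhs-correct {n} eq = ≡-trans (codeLen-correct (proj₁ (unpair n))) (cong (λ p → len (proj₁ p)) eq)

rhs-correct : ∀ {n s t} → decodePair n ≡ (s , t) → rhs n ≡ len t
rhs-correct {n} eq = ≡-trans (codeLen-correct (proj₂ (unpair n))) (cong (λ p → len (proj₂ p)) eq)

-- The congruence on exponents

pow : ℕ → Term
pow zero    = ε
pow (suc n) = x₀ · pow n

_~[_]_ : ℕ → ℕ → ℕ → Set
a ~[ e ] b = pow a ≈[ e ] pow b

≡⇒~ : ∀ {e a b} → a ≡ b → a ~[ e ] b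
≡⇒~ refl = refl

pow-+ : ∀ {e} a b → pow (a + b) ≈[ e ] (pow a · pow b)
pow-+ zero    b = sym idˡ
pow-+ (suc a) b = trans (cong· refl (pow-+ a b)) (sym assoc)

normal : ∀ {e} s → s ≈[ e ] pow (len s)
normal x₀      = sym idʳ
normal ε       = refl
normal (s · t) = trans (cong· (normal s) (normal t)) (sym (pow-+ (len s) (len t)))

len-pow : ∀ n → len (pow n) ≡ n
len-pow zero    = refl
len-pow (suc n) = cong suc (len-pow n)

≈⇒~ : ∀ {e s t} → s ≈[ e ] t → len s ~[ e ] len t
≈⇒~ {s = s} {t} st = trans (sym (normal s)) (trans st (normal t))

~⇒≈ : ∀ {e s t} → len s ~[ e ] len t → s ≈[ e ] t
~⇒≈ {s = s} {t} st = trans (normal s) (trans st (sym (normal t)))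

~-+ : ∀ {e a b c d} → a ~[ e ] b → c ~[ e ] d → (a + c) ~[ e ] (b + d)
~-+ {a = a} {b} {c} {d} ab cd = trans (pow-+ a c) (trans (cong· ab cd) (sym (pow-+ b d)))

~-* : ∀ {e a b} n → a ~[ e ] b → (n * a) ~[ e ] (n * b)
~-* zero    ab = refl
~-* (suc n) ab = ~-+ ab (~-* n ab)

-- Certificates for the congruence: lists of applications of the axioms

Rewrites : ℕ → ℕ → ℕ → Set
Rewrites e a b = ∃₂ λ n c → n ∈W e × a ≡ lhs n + c × b ≡ rhs n + c

Connected : ℕ → ℕ → ℕ → Set
Connected e = EqClosure (Rewrites e)

≡⇒connected : ∀ {e a b} → a ≡ b → Connected e a b
≡⇒connected refl = ε

-- The exponent `c` is a context: for a product, one factor is rewritten while the other belongs to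
-- the context. The monoid laws become equations between lengths.
≈⇒connected : ∀ {e s t} → s ≈[ e ] t → ∀ c → Connected e (len s + c) (len t + c)
≈⇒connected {s = s} {t} (ax {n = n} n∈W eq) c = fwd
  (n , c , n∈W , cong (_+ c) (≡-sym (lhs-correct {n} eq)) , cong (_+ c) (≡-sym (rhs-correct {n} eq))) ◅ ε
≈⇒connected refl c = ε
≈⇒connected {e} (sym st) c = Eq.symmetric (Rewrites e) (≈⇒connected st c)
≈⇒connected (trans st tu) c = ≈⇒connected st c ◅◅ ≈⇒connected tu c
≈⇒connected (cong· {s = s} {s'} {t} {t'} ss' tt') c =
  ≡⇒connected (+-assoc (len s) (len t) c) ◅◅
  ≈⇒connected ss' (len t + c) ◅◅
  ≡⇒connected (swap (len s') (len t)) ◅◅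
  ≈⇒connected tt' (len s' + c) ◅◅
  ≡⇒connected (≡-trans (swap (len t') (len s')) (≡-sym (+-assoc (len s') (len t') c)))
  where
  swap : ∀ m n → m + (n + c) ≡ n + (m + c)
  swap m n = ≡-trans (≡-sym (+-assoc m n c)) (≡-trans (cong (_+ c) (+-comm m n)) (+-assoc n m c))
≈⇒connected (assoc {s = s} {t} {u}) c = ≡⇒connected (cong (_+ c) (+-assoc (len s) (len t) (len u)))
≈⇒connected (comm {s = s} {t}) c = ≡⇒connected (cong (_+ c) (+-comm (len s) (len t)))
≈⇒connected idˡ c = ε
≈⇒connected (idʳ {s = s}) c = ≡⇒connected (cong (_+ c) (+-identityʳ (len s)))

-- An exponent too small to contain `u` is left alone, so every number can be read as a sound move
-- and certificates need no validity check.
replace : ℕ → ℕ → ℕ → ℕ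
replace u v a = cond (u ∸ a) ((a ∸ u) + v) a

replace-~ : ∀ {e u v} a → u ~[ e ] v → a ~[ e ] replace u v a
replace-~ {e} {u} {v} a uv = go (u ∸ a) refl
  where
  go : ∀ d → u ∸ a ≡ d → a ~[ e ] cond d ((a ∸ u) + v) a
  go zero    eq = trans (≡⇒~ (≡-sym (m∸n+n≡m (m∸n≡0⇒m≤n eq)))) (~-+ {a = a ∸ u} {b = a ∸ u} refl uv)
  go (suc _) _  = refl

replace-applies : ∀ u v c → replace u v (u + c) ≡ v + c
replace-applies u v c rewrite m≤n⇒m∸n≡0 (m≤m+n u c) | m+n∸m≡n u c = +-comm c v

-- Applies the axiom coded by n, from left to right if d = 0, provided that w witnesses n ∈ W e.
apply : ℕ → ℕ → ℕ → ℕ → ℕ → ℕ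
apply e n d w a = cond (haltsBy n e w) a (cond d (replace (lhs n) (rhs n) a) (replace (rhs n) (lhs n) a))

apply-~ : ∀ e n d w a → a ~[ e ] apply e n d w a
apply-~ e n d w a = go (haltsBy n e w) refl d
  where
  axiom : haltsBy n e w ≢ 0 → lhs n ~[ e ] rhs n
  axiom nz = trans (≡⇒~ (lhs-correct {n} refl))
    (trans (≈⇒~ (ax (haltsBy⇒∈W w nz) refl)) (≡⇒~ (≡-sym (rhs-correct {n} refl))))
  go : ∀ h → haltsBy n e w ≡ h → ∀ d →
       a ~[ e ] cond h a (cond d (replace (lhs n) (rhs n) a) (replace (rhs n) (lhs n) a))
  go zero    _  d       = refl
  go (suc _) eq zero    = replace-~ a (axiom (λ z → 1+n≢0 (≡-trans (≡-sym eq) z)))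
  go (suc _) eq (suc _) = replace-~ a (sym (axiom (λ z → 1+n≢0 (≡-trans (≡-sym eq) z))))

apply-axiom : ∀ e n d w a → haltsBy n e w ≢ 0 →
  apply e n d w a ≡ cond d (replace (lhs n) (rhs n) a) (replace (rhs n) (lhs n) a)
apply-axiom e n d w a nz with haltsBy n e w
... | zero  = ⊥-elim (nz refl)
... | suc _ = refl

-- The number of moves is supplied separately, so the list `L` of moves consists of nested pairs
-- without an end marker.
follow : ℕ → ℕ × ℕ → ℕ × ℕ
follow e (L , a) =
  let i = unpair (proj₁ (unpair L))
      q = unpair (proj₂ i)
  in proj₂ (unpair L) , apply e (proj₁ i) (proj₁ q) (proj₂ q) a

follow-pair : ∀ e n d w L a → follow e (pair (pair n (pair d w)) L , a) ≡ (L , apply e n d w a)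
follow-pair e n d w L a =
  ≡-trans (cong (λ p → let i = unpair (proj₁ p) ; q = unpair (proj₂ i)
                       in proj₂ p , apply e (proj₁ i) (proj₁ q) (proj₂ q) a)
            (unpair-pair (pair n (pair d w)) L))
    (≡-trans (cong (λ i → let q = unpair (proj₂ i) in L , apply e (proj₁ i) (proj₁ q) (proj₂ q) a)
               (unpair-pair n (pair d w)))
      (cong (λ q → L , apply e n (proj₁ q) (proj₂ q) a) (unpair-pair d w)))

follow-once-~ : ∀ e c → proj₂ c ~[ e ] proj₂ (follow e c)
follow-once-~ e (L , a) =
  let i = unpair (proj₁ (unpair L))
      q = unpair (proj₂ i)
  in apply-~ e (proj₁ i) (proj₁ q) (proj₂ q) a

follow-~ : ∀ e k L a → a ~[ e ] proj₂ (iterate (follow e) k (L , a))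
follow-~ e zero    L a = refl
follow-~ e (suc k) L a = trans (follow-~ e k L a) (follow-once-~ e (iterate (follow e) k (L , a)))

Follows : ℕ → ℕ → ℕ → Set
Follows e a b = ∃₂ λ k L → proj₂ (iterate (follow e) k (L , a)) ≡ b

follows-apply : ∀ {e a b} n d w → Follows e (apply e n d w a) b → Follows e a b
follows-apply {e} {a} n d w (k , L , eq) = suc k , pair (pair n (pair d w)) L ,
  ≡-trans (cong proj₂ (≡-trans (iterate-suc (follow e) k (pair (pair n (pair d w)) L , a))
    (cong (iterate (follow e) k) (follow-pair e n d w L a)))) eq

connected⇒follows : ∀ {e a b} → Connected e a b → Follows e a b
connected⇒follows ε = 0 , 0 , refl
connected⇒follows {e} {a} {b} (fwd (n , c , n∈W , refl , refl) ◅ rest) =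
  let (w , nz) = ∈W⇒haltsBy n∈W
  in follows-apply n 0 w (subst (λ a' → Follows e a' b)
       (≡-sym (≡-trans (apply-axiom e n 0 w a nz) (replace-applies (lhs n) (rhs n) c))) (connected⇒follows rest))
connected⇒follows {e} {a} {b} (bwd (n , c , n∈W , refl , refl) ◅ rest) =
  let (w , nz) = ∈W⇒haltsBy n∈W
  in follows-apply n 1 w (subst (λ a' → Follows e a' b)
       (≡-sym (≡-trans (apply-axiom e n 1 w a nz) (replace-applies (rhs n) (lhs n) c))) (connected⇒follows rest))

-- The congruence is enumerable

cond-dist : ∀ m n → cond (dist m n) 1 0 ≢ 0 → m ≡ n
cond-dist m n = go (dist m n) refl
  where
  go : ∀ d → dist m n ≡ d → cond d 1 0 ≢ 0 → m ≡ n
  go zero    eq _  = dist-zero m n eq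
  go (suc _) _  nz = ⊥-elim (nz refl)

opaque
  certifies : ℕ × ℕ × ℕ → ℕ
  certifies (x , e , t) =
    let q = unpair x
        k = unpair t
    in cond (dist (proj₂ (iterate (follow e) (proj₁ k) (proj₂ k , proj₁ q))) (proj₁ q + suc (proj₂ q))) 1 0

  certifiesᵖ : PrimRec {nat ⊗ nat ⊗ nat} {nat} certifies
  certifiesᵖ = condᵖ (distᵖ ⊙ (π₂ ⊙ iterᵖ {nat ⊗ nat ⊗ nat} {nat ⊗ nat} (π₁ ⊙ k) (π₂ ⊙ k ▵ π₁ ⊙ q) (followᵖ ⊙ (π₁ ⊙ π₂ ⊙ π₁ ▵ π₂))
      ▵ addᵖ ⊙ (π₁ ⊙ q ▵ sucᵖ ⊙ π₂ ⊙ q))) (constᵖ 1) zeroᵖ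
    where
    q : PrimRec {nat ⊗ nat ⊗ nat} {nat ⊗ nat} (λ x → unpair (proj₁ x))
    q = unpairᵖ ⊙ π₁
    k : PrimRec {nat ⊗ nat ⊗ nat} {nat ⊗ nat} (λ x → unpair (proj₂ (proj₂ x)))
    k = unpairᵖ ⊙ π₂ ⊙ π₂
    replaceᵖ : PrimRec {nat ⊗ nat ⊗ nat} {nat} (λ (u , v , a) → replace u v a)
    replaceᵖ = condᵖ (monusᵖ ⊙ (π₁ ▵ π₂ ⊙ π₂)) (addᵖ ⊙ (monusᵖ ⊙ (π₂ ⊙ π₂ ▵ π₁) ▵ π₁ ⊙ π₂)) (π₂ ⊙ π₂)
    lhsᵖ : PrimRec {nat} {nat} lhs
    lhsᵖ = codeLenᵖ ⊙ π₁ ⊙ unpairᵖ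
    rhsᵖ : PrimRec {nat} {nat} rhs
    rhsᵖ = codeLenᵖ ⊙ π₂ ⊙ unpairᵖ
    applyᵖ : PrimRec {nat ⊗ nat ⊗ nat ⊗ nat ⊗ nat} {nat} (λ (e , n , d , w , a) → apply e n d w a)
    applyᵖ = condᵖ (haltsByᵖ ⊙ (n ▵ π₁ ▵ π₁ ⊙ π₂ ⊙ π₂ ⊙ π₂)) a
      (condᵖ (π₁ ⊙ π₂ ⊙ π₂) (replaceᵖ ⊙ (lhsᵖ ⊙ n ▵ rhsᵖ ⊙ n ▵ a)) (replaceᵖ ⊙ (rhsᵖ ⊙ n ▵ lhsᵖ ⊙ n ▵ a)))
      where
      n : PrimRec {nat ⊗ nat ⊗ nat ⊗ nat ⊗ nat} {nat} (λ x → proj₁ (proj₂ x))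
      n = π₁ ⊙ π₂
      a : PrimRec {nat ⊗ nat ⊗ nat ⊗ nat ⊗ nat} {nat} (λ x → proj₂ (proj₂ (proj₂ (proj₂ x))))
      a = π₂ ⊙ π₂ ⊙ π₂ ⊙ π₂
    followᵖ : PrimRec {nat ⊗ nat ⊗ nat} {nat ⊗ nat} (λ x → follow (proj₁ x) (proj₂ x))
    followᵖ = π₂ ⊙ L ▵ applyᵖ ⊙ (π₁ ▵ π₁ ⊙ i ▵ π₁ ⊙ j ▵ π₂ ⊙ j ▵ π₂ ⊙ π₂)
      where
      L : PrimRec {nat ⊗ nat ⊗ nat} {nat ⊗ nat} (λ x → unpair (proj₁ (proj₂ x)))
      L = unpairᵖ ⊙ π₁ ⊙ π₂
      i : PrimRec {nat ⊗ nat ⊗ nat} {nat ⊗ nat} (λ x → unpair (proj₁ (unpair (proj₁ (proj₂ x)))))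
      i = unpairᵖ ⊙ π₁ ⊙ L
      j : PrimRec {nat ⊗ nat ⊗ nat} {nat ⊗ nat} (λ x → unpair (proj₂ (unpair (proj₁ (unpair (proj₁ (proj₂ x)))))))
      j = unpairᵖ ⊙ π₂ ⊙ i

  certifies⇒~ : ∀ e i p t → certifies (pair i p , e , t) ≢ 0 → i ~[ e ] (i + suc p)
  certifies⇒~ e i p t nz = trans (follow-~ e (proj₁ k) (proj₂ k) i)
    (≡⇒~ (cond-dist (proj₂ (iterate (follow e) (proj₁ k) (proj₂ k , i))) (i + suc p)
      (subst (λ q → cond (dist (proj₂ (iterate (follow e) (proj₁ k) (proj₂ k , proj₁ q))) (proj₁ q + suc (proj₂ q))) 1 0 ≢ 0)
        (unpair-pair i p) nz)))
    where
    k : ℕ × ℕ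
    k = unpair t

  ~⇒certifies : ∀ e i p → i ~[ e ] (i + suc p) → ∃ λ t → certifies (pair i p , e , t) ≢ 0
  ~⇒certifies e i p i~ = found (connected⇒follows
    (≡⇒connected (≡-sym (≡-trans (+-identityʳ _) (len-pow i))) ◅◅ ≈⇒connected i~ 0 ◅◅
     ≡⇒connected (≡-trans (+-identityʳ _) (len-pow (i + suc p)))))
    where
    found : Follows e i (i + suc p) → ∃ λ t → certifies (pair i p , e , t) ≢ 0
    found (k , L , eq) = pair k L , λ z → 1+n≢0 (≡-trans (≡-sym (≡-trans
      (cong₂ (λ q k → cond (dist (proj₂ (iterate (follow e) (proj₁ k) (proj₂ k , proj₁ q))) (proj₁ q + suc (proj₂ q))) 1 0)
        (unpair-pair i p) (unpair-pair k L))
      (cong (λ d → cond d 1 0) (≡-trans (cong (λ m → dist m (i + suc p)) eq) (dist-self (i + suc p)))))) z)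

EnumeratesCongruence : (ℕ → ℕ) → Set
EnumeratesCongruence h = ∀ e i p → (pair i p ∈W h e → i ~[ e ] (i + suc p)) × (i ~[ e ] (i + suc p) → pair i p ∈W h e)

congruence-enumerator : ∃ λ h → Computable h × EnumeratesCongruence h
congruence-enumerator with enumerate certifiesᵖ
... | h , computable , spec = h , computable , λ e i p →
  (λ m → let (t , nz) = proj₁ (spec e (pair i p)) m in certifies⇒~ e i p t nz) ,
  (λ i~ → let (t , nz) = ~⇒certifies e i p i~ in proj₂ (spec e (pair i p)) t nz)

-- Enumerating the axioms that collapse powers

powerCode : ℕ → ℕ
-- In the coding of terms 1 stands for `ε` and 0 for `x₀`, so each round multiplies by `x₀` on the
-- left.
powerCode n = iterate (λ c → suc (suc (pair 0 c))) n 1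

decode-powerCode : ∀ f n → powerCode n ≤ f → decodeTermF f (powerCode n) ≡ pow n
decode-powerCode f zero _ = refl
decode-powerCode (suc f) (suc n) (s≤s le) =
  ≡-trans (cong (λ q → decodeTermF f (proj₁ q) · decodeTermF f (proj₂ q)) (unpair-pair 0 (powerCode n)))
    (cong (x₀ ·_) (decode-powerCode f n (≤-trans (snd≤pair 0 (powerCode n)) (≤-trans (n≤1+n _) le))))

collapseCode : ℕ → ℕ
collapseCode n = pair (powerCode n) (powerCode (suc n))

decodePair-collapseCode : ∀ n → decodePair (collapseCode n) ≡ (pow n , pow (suc n))
decodePair-collapseCode n =
  ≡-trans (cong (λ q → decodeTerm (proj₁ q) , decodeTerm (proj₂ q)) (unpair-pair (powerCode n) (powerCode (suc n))))
    (cong₂ _,_ (decode-powerCode (powerCode n) n ≤-refl) (decode-powerCode (powerCode (suc n)) (suc n) ≤-refl))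

opaque
  -- The stage `t` codes both a candidate exponent and a witness that it belongs to `W e`, so that a
  -- single search covers both.
  collapses : ℕ × ℕ × ℕ → ℕ
  collapses (y , e , t) = let q = unpair t in cond (dist y (collapseCode (proj₁ q))) (haltsBy (proj₁ q) e (proj₂ q)) 0

  collapsesᵖ : PrimRec {nat ⊗ nat ⊗ nat} {nat} collapses
  collapsesᵖ = condᵖ (distᵖ ⊙ (π₁ ▵ pairᵖ ⊙ (powerCodeᵖ ▵ powerCodeᵖ ⊙ sucᵖ) ⊙ π₁ ⊙ q))
                 (haltsByᵖ ⊙ (π₁ ⊙ q ▵ π₁ ⊙ π₂ ▵ π₂ ⊙ q)) zeroᵖ
    where
    q : PrimRec {nat ⊗ nat ⊗ nat} {nat ⊗ nat} (λ x → unpair (proj₂ (proj₂ x)))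
    q = unpairᵖ ⊙ π₂ ⊙ π₂
    powerCodeᵖ : PrimRec {nat} {nat} powerCode
    powerCodeᵖ = iterᵖ {nat} {nat} idᵖ (constᵖ 1) (sucᵖ ⊙ sucᵖ ⊙ pairᵖ ⊙ (zeroᵖ ▵ π₂))

  collapses⇒∈W : ∀ e y t → collapses (y , e , t) ≢ 0 → ∃ λ n → n ∈W e × y ≡ collapseCode n
  collapses⇒∈W e y t nz = go (dist y (collapseCode n)) refl nz
    where
    n : ℕ
    n = proj₁ (unpair t)
    go : ∀ d → dist y (collapseCode n) ≡ d → cond d (haltsBy n e (proj₂ (unpair t))) 0 ≢ 0 →
         ∃ λ n → n ∈W e × y ≡ collapseCode n
    go zero    eq nz = n , haltsBy⇒∈W (proj₂ (unpair t)) nz , dist-zero y (collapseCode n) eq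
    go (suc _) _  nz = ⊥-elim (nz refl)

  ∈W⇒collapses : ∀ e n → n ∈W e → ∃ λ t → collapses (collapseCode n , e , t) ≢ 0
  ∈W⇒collapses e n n∈W = let (w , nz) = ∈W⇒haltsBy n∈W in pair n w ,
    λ z → nz (≡-trans (≡-sym (≡-trans
      (cong (λ q → cond (dist (collapseCode n) (collapseCode (proj₁ q))) (haltsBy (proj₁ q) e (proj₂ q)) 0) (unpair-pair n w))
      (cong (λ d → cond d (haltsBy n e w) 0) (dist-self (collapseCode n))))) z)

Collapses : (ℕ → ℕ) → Set
Collapses h = ∀ e → (∀ {y} → y ∈W h e → ∃ λ n → n ∈W e × y ≡ collapseCode n)
                    × (∀ {n} → n ∈W e → collapseCode n ∈W h e)

collapser : ∃ λ h → Computable h × Collapses h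
collapser with enumerate collapsesᵖ
... | h , computable , spec = h , computable , λ e →
  (λ {y} m → let (t , nz) = proj₁ (spec e y) m in collapses⇒∈W e y t nz) ,
  (λ {n} m → let (t , nz) = ∈W⇒collapses e n m in proj₂ (spec e (collapseCode n)) t nz)

-- Isomorphism is equality of the congruences

_⊑_ : ℕ → ℕ → Set
e ⊑ i = ∀ {a b} → a ~[ e ] b → a ~[ i ] b

iso-sym : ∀ {e i} → CM₁Iso e i → CM₁Iso i e
iso-sym I = record
  { f = g ; g = f ; f-resp = g-resp ; g-resp = f-resp ; gf = fg ; fg = gf
  ; f-· = λ s t → trans (g-resp (trans (cong· (sym (fg s)) (sym (fg t))) (sym (f-· (g s) (g t))))) (gf (g s · g t))
  ; f-ε = trans (g-resp (sym f-ε)) (gf ε)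
  }
  where open CM₁Iso I

-- If f x₀ = xᵏ and g x₀ = xˡ, then a ~ b in the source gives k a ~ k b, hence l k a ~ l k b, in
-- the target, where l k ~ 1.
iso⇒⊑ : ∀ {e i} → CM₁Iso e i → e ⊑ i
iso⇒⊑ {e} {i} I {a} {b} ab =
  trans (sym (cancel a)) (trans (~-* l (trans (sym (f-pow a)) (trans (f-resp ab) (f-pow b)))) (cancel b))
  where
  open CM₁Iso I
  k l : ℕ
  k = len (f x₀)
  l = len (g x₀)
  f-pow : ∀ n → f (pow n) ≈[ i ] pow (n * k)
  f-pow zero    = f-ε
  f-pow (suc n) = trans (f-· x₀ (pow n)) (trans (cong· (normal (f x₀)) (f-pow n)) (sym (pow-+ k (n * k))))
  lk~1 : (l * k) ~[ i ] 1
  lk~1 = trans (sym (f-pow l)) (trans (f-resp (sym (normal (g x₀)))) (trans (fg x₀) (sym idʳ)))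
  cancel : ∀ n → (l * (n * k)) ~[ i ] n
  cancel n = trans (≡⇒~ (≡-trans (≡-sym (*-assoc l n k)) (≡-trans (cong (_* k) (*-comm l n)) (*-assoc n l k))))
    (trans (~-* n lk~1) (≡⇒~ (*-identityʳ n)))

⊑⇒iso : ∀ {e i} → e ⊑ i → i ⊑ e → CM₁Iso e i
⊑⇒iso ei ie = record
  { f = λ s → s ; g = λ s → s ; f-resp = λ st → ~⇒≈ (ei (≈⇒~ st)) ; g-resp = λ st → ~⇒≈ (ie (≈⇒~ st))
  ; f-· = λ _ _ → refl ; f-ε = refl ; gf = λ _ → refl ; fg = λ _ → refl
  }

-- The least pair of a congruence determines it

~-shift : ∀ {e a b} c → a ~[ e ] b → (c + a) ~[ e ] (c + b)
~-shift c ab = ~-+ {a = c} {b = c} refl ab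

~-weaken : ∀ {e a d r} → a ≤ r → a ~[ e ] (a + d) → r ~[ e ] (r + d)
~-weaken {e} {a} {d} {r} a≤r ad =
  trans (≡⇒~ (≡-sym (m∸n+n≡m a≤r))) (trans (~-shift (r ∸ a) ad)
    (≡⇒~ (≡-trans (≡-sym (+-assoc (r ∸ a) a d)) (cong (_+ d) (m∸n+n≡m a≤r)))))

~-multiple : ∀ {e a d} q → a ~[ e ] (a + d) → a ~[ e ] (a + q * d)
~-multiple {a = a} zero ad = ≡⇒~ (≡-sym (+-identityʳ a))
~-multiple {a = a} {d} (suc q) ad = trans (~-multiple q ad)
  (trans (~-weaken (m≤m+n a (q * d)) ad)
    (≡⇒~ (≡-trans (+-assoc a (q * d) d) (cong (a +_) (+-comm (q * d) d)))))

module _ {h} (spec : EnumeratesCongruence h) {e i p} (min : IsMinW (h e) (pair i p)) where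

  i~ : i ~[ e ] (i + suc p)
  i~ = proj₁ (spec e i p) (proj₁ min)

  -- Adding `i` periods `suc d` to `a` reaches an equivalent exponent `far ≥ i`, where `suc p` is a
  -- period; so `suc p` is a period at `a` as well, and `a < i` would give the smaller code
  -- `pair a p`.
  min-index : ∀ {a d} → a ~[ e ] (a + suc d) → i ≤ a
  min-index {a} {d} ad with i ≤? a
  ... | yes i≤a = i≤a
  ... | no i≰a = ⊥-elim (proj₂ min (pair a p) (pair-monoˡ-< p (≰⇒> i≰a)) (proj₂ (spec e a p) ap))
    where
    far : ℕ
    far = a + i * suc d
    i≤far : i ≤ far
    i≤far = ≤-trans (m≤m*n i (suc d)) (m≤n+m (i * suc d) a)
    ap : a ~[ e ] (a + suc p)
    ap = trans (~-multiple i ad) (trans (~-weaken i≤far i~)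
      (~-+ {c = suc p} {d = suc p} (sym (~-multiple i ad)) refl))

  -- Now `i` is moved up by multiples of `suc p` to an equivalent exponent `far ≥ a`, so `d` is a
  -- period at `i`. Its remainder modulo `suc p` is then also one, and a remainder `suc r` would
  -- give the smaller code `pair i r`.
  min-period : ∀ {a d} → a ~[ e ] (a + d) → ∃ λ q → d ≡ q * suc p
  min-period {a} {d} ad = d / suc p , go (d % suc p) refl
    where
    far : ℕ
    far = i + a * suc p
    i~far : i ~[ e ] far
    i~far = ~-multiple a i~
    a≤far : a ≤ far
    a≤far = ≤-trans (m≤m*n a (suc p)) (m≤n+m (a * suc p) i)
    id~ : i ~[ e ] (i + d)
    id~ = trans i~far (trans (~-weaken a≤far ad) (~-+ {c = d} {d = d} (sym i~far) refl))
    ir~ : i ~[ e ] (i + d % suc p)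
    ir~ = trans id~ (trans (≡⇒~ (≡-trans (cong (i +_) (m≡m%n+[m/n]*n d (suc p))) (≡-sym (+-assoc i (d % suc p) _))))
      (sym (~-multiple (d / suc p) (~-weaken (m≤m+n i (d % suc p)) i~))))
    go : ∀ r → d % suc p ≡ r → d ≡ d / suc p * suc p
    go zero    eq = ≡-trans (m≡m%n+[m/n]*n d (suc p)) (cong (_+ d / suc p * suc p) eq)
    go (suc r) eq = ⊥-elim (proj₂ min (pair i r) (pair-monoʳ-< i (≤-pred (subst (_< suc p) eq (m%n<n d (suc p)))))
      (proj₂ (spec e i r) (subst (λ r → i ~[ e ] (i + r)) eq ir~)))

  -- The relation `i ~ i + suc p` generates all others: they start at or above `i` and their period
  -- is a multiple of `suc p`.
  min⊑ : ∀ {e'} → i ~[ e' ] (i + suc p) → ∀ {a d} → a ~[ e ] (a + suc d) → a ~[ e' ] (a + suc d)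
  min⊑ {e'} i~' {a} ad = let (q , eq) = min-period ad in
    trans (~-multiple q (~-weaken (min-index ad) i~')) (≡⇒~ (cong (a +_) (≡-sym eq)))

⊑-from-< : ∀ {e i} → (∀ {a d} → a ~[ e ] (a + suc d) → a ~[ i ] (a + suc d)) → e ⊑ i
⊑-from-< {e} {i} up {a} {b} ab with <-cmp a b
... | tri< a<b _ _ = trans (up (trans ab (≡⇒~ (≡-sym eq)))) (≡⇒~ eq)
  where
  eq : a + suc (b ∸ suc a) ≡ b
  eq = ≡-trans (+-suc a _) (m+[n∸m]≡n a<b)
... | tri≈ _ refl _ = refl
... | tri> _ _ b<a = sym (trans (up (trans (sym ab) (≡⇒~ (≡-sym eq)))) (≡⇒~ eq))
  where
  eq : b + suc (a ∸ suc b) ≡ a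
  eq = ≡-trans (+-suc b _) (m+[n∸m]≡n b<a)

emin⇒⊑ : ∀ {h} → EnumeratesCongruence h → ∀ {e i} → Emin (h e) (h i) → e ⊑ i
emin⇒⊑ spec (inj₁ (m , minₑ , minᵢ)) with pair-surjective m
... | a , p , refl = ⊑-from-< (min⊑ spec minₑ (proj₁ (spec _ a p) (proj₁ minᵢ)))
emin⇒⊑ spec (inj₂ (emptyₑ , _)) = ⊑-from-< λ {a} {d} ad → ⊥-elim (emptyₑ (pair a d) (proj₂ (spec _ a d) ad))

emin-sym : ∀ {e i} → Emin e i → Emin i e
emin-sym (inj₁ (m , me , mi)) = inj₁ (m , mi , me)
emin-sym (inj₂ (ee , ei))     = inj₂ (ei , ee)

min-or-empty : ExcludedMiddle 0ℓ → ∀ e → (∃ λ m → IsMinW e m) ⊎ EmptyW e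
min-or-empty em e with em {∃ λ n → n ∈W e}
... | no none = inj₂ λ x x∈W → none (x , x∈W)
... | yes (n , n∈W) = inj₁ (least n n ≤-refl n∈W)
  where
  least : ∀ N n → n ≤ N → n ∈W e → ∃ λ m → IsMinW e m
  least N n n≤N n∈W with em {∃ λ k → k < n × k ∈W e}
  ... | no none = n , n∈W , λ k k<n k∈W → none (k , k<n , k∈W)
  least zero    _ z≤n n∈W | yes (_ , () , _)
  least (suc N) n n≤N n∈W | yes (k , k<n , k∈W) = least N k (≤-pred (≤-trans k<n n≤N)) k∈W

⊑⇒W⊆ : ∀ {h} → EnumeratesCongruence h → ∀ {e i} → e ⊑ i → ∀ x → x ∈W h e → x ∈W h i
⊑⇒W⊆ spec ei x x∈W with pair-surjective x
... | a , p , refl = proj₂ (spec _ a p) (ei (proj₁ (spec _ a p) x∈W))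

-- Equal congruences give the same set of coded pairs, so it suffices to decide the case for one of
-- the two indices.
⊑⇒emin : ExcludedMiddle 0ℓ → ∀ {h} → EnumeratesCongruence h → ∀ {e i} → e ⊑ i → i ⊑ e → Emin (h e) (h i)
⊑⇒emin em {h} spec {e} {i} ei ie with min-or-empty em (h e)
... | inj₁ (m , m∈W , least) =
  inj₁ (m , (m∈W , least) , (⊑⇒W⊆ spec ei m m∈W , λ k k<m k∈W → least k k<m (⊑⇒W⊆ spec ie k k∈W)))
... | inj₂ empty = inj₂ (empty , λ x x∈W → empty x (⊑⇒W⊆ spec ie x x∈W))

-- Collapsing above the minimum

-- Every rule except `ax` is available for every index.
≈-least : ∀ {e i s t} → (∀ {n s t} → n ∈W e → decodePair n ≡ (s , t) → s ≈[ i ] t) → s ≈[ e ] t → s ≈[ i ] t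
≈-least axioms (ax n∈W eq)   = axioms n∈W eq
≈-least axioms refl          = refl
≈-least axioms (sym st)      = sym (≈-least axioms st)
≈-least axioms (trans st tu) = trans (≈-least axioms st) (≈-least axioms tu)
≈-least axioms (cong· st uv) = cong· (≈-least axioms st) (≈-least axioms uv)
≈-least axioms assoc         = assoc
≈-least axioms comm          = comm
≈-least axioms idˡ           = idˡ
≈-least axioms idʳ           = idʳ

module _ {h} (spec : Collapses h) where

  collapse-~ : ∀ {e n} → n ∈W e → n ~[ h e ] suc n
  collapse-~ {e} {n} n∈W = ax (proj₂ (spec e) n∈W) (decodePair-collapseCode n)

  collapse-⊑ : ∀ {e i} → (∀ {n} → n ∈W e → n ~[ h i ] suc n) → h e ⊑ h i
  collapse-⊑ {e} {i} up = ≈-least axiom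
    where
    axiom : ∀ {y s t} → y ∈W h e → decodePair y ≡ (s , t) → s ≈[ h i ] t
    axiom y∈W eq with proj₁ (spec e) y∈W
    ... | n , n∈W , refl with ≡-trans (≡-sym (decodePair-collapseCode n)) eq
    ... | refl = up n∈W

  emin⇒collapse-⊑ : ∀ {e i} → Emin e i → h e ⊑ h i
  emin⇒collapse-⊑ (inj₁ (m , (_ , least) , (m∈W , _))) = collapse-⊑ λ {n} n∈W →
    trans (~-weaken (≮⇒≥ λ n<m → least n n<m n∈W) (trans (collapse-~ m∈W) (≡⇒~ (+-comm 1 m)))) (≡⇒~ (+-comm n 1))
  emin⇒collapse-⊑ (inj₂ (empty , _)) = collapse-⊑ λ {n} n∈W → ⊥-elim (empty n n∈W)

  -- The Rees congruence of the ideal of exponents at least `k`. It satisfies the collapsing axioms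
  -- whenever `k` is a lower bound of the set, and thus shows that powers below `k` stay distinct.
  Collapsed : ℕ → ℕ → ℕ → Set
  Collapsed k a b = a ≡ b ⊎ k ≤ a × k ≤ b

  collapsed-sym : ∀ {k a b} → Collapsed k a b → Collapsed k b a
  collapsed-sym (inj₁ eq)        = inj₁ (≡-sym eq)
  collapsed-sym (inj₂ (ka , kb)) = inj₂ (kb , ka)

  collapsed-trans : ∀ {k a b c} → Collapsed k a b → Collapsed k b c → Collapsed k a c
  collapsed-trans (inj₁ refl)     bc              = bc
  collapsed-trans (inj₂ ab)       (inj₁ refl)     = inj₂ ab
  collapsed-trans (inj₂ (ka , _)) (inj₂ (_ , kc)) = inj₂ (ka , kc)

  collapsed-+ : ∀ {k a b c d} → Collapsed k a b → Collapsed k c d → Collapsed k (a + c) (b + d)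
  collapsed-+ (inj₁ refl) (inj₁ refl) = inj₁ refl
  collapsed-+ {a = a} {b} {c} {d} (inj₂ (ka , kb)) _ = inj₂ (≤-trans ka (m≤m+n a c) , ≤-trans kb (m≤m+n b d))
  collapsed-+ {a = a} {b} {c} {d} (inj₁ _) (inj₂ (kc , kd)) = inj₂ (≤-trans kc (m≤n+m c a) , ≤-trans kd (m≤n+m d b))

  ≈⇒collapsed : ∀ {i k s t} → (∀ {n} → n ∈W i → k ≤ n) → s ≈[ h i ] t → Collapsed k (len s) (len t)
  ≈⇒collapsed {i} {k} bound (ax y∈W eq) with proj₁ (spec i) y∈W
  ... | n , n∈W , refl with ≡-trans (≡-sym (decodePair-collapseCode n)) eq
  ... | refl rewrite len-pow n = inj₂ (bound n∈W , m≤n⇒m≤1+n (bound n∈W))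
  ≈⇒collapsed bound refl          = inj₁ refl
  ≈⇒collapsed bound (sym st)      = collapsed-sym (≈⇒collapsed bound st)
  ≈⇒collapsed bound (trans st tu) = collapsed-trans (≈⇒collapsed bound st) (≈⇒collapsed bound tu)
  ≈⇒collapsed bound (cong· st uv) = collapsed-+ (≈⇒collapsed bound st) (≈⇒collapsed bound uv)
  ≈⇒collapsed bound (assoc {s = s} {t} {u}) = inj₁ (+-assoc (len s) (len t) (len u))
  ≈⇒collapsed bound (comm {s = s} {t}) = inj₁ (+-comm (len s) (len t))
  ≈⇒collapsed bound idˡ = inj₁ refl
  ≈⇒collapsed bound (idʳ {s = s}) = inj₁ (+-identityʳ (len s))

  bound≤ : ∀ {i k m} → (∀ {n} → n ∈W i → k ≤ n) → m ~[ h i ] suc m → k ≤ m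
  bound≤ {k = k} {m} bound mm with ≈⇒collapsed bound mm
  ... | c rewrite len-pow m with c
  ... | inj₁ m≡1+m  = ⊥-elim (1+n≢n (≡-sym m≡1+m))
  ... | inj₂ (km , _) = km

  min≤ : ∀ {e i m m'} → IsMinW e m → IsMinW i m' → h e ⊑ h i → m' ≤ m
  min≤ (m∈W , _) (_ , least) ei = bound≤ (λ {n} n∈W → ≮⇒≥ λ n<m' → least n n<m' n∈W) (ei (collapse-~ m∈W))

  min-nonempty : ∀ {e i m} → IsMinW e m → EmptyW i → ¬ (h e ⊑ h i)
  min-nonempty {m = m} (m∈W , _) empty ei =
    -- Every number is a lower bound of the empty set; `suc m` is the one that contradicts `k ≤ m`.
    1+n≰n (bound≤ {k = suc m} (λ {n} n∈W → ⊥-elim (empty n n∈W)) (ei (collapse-~ m∈W)))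

  ⊑⇒collapse-emin : ExcludedMiddle 0ℓ → ∀ {e i} → h e ⊑ h i → h i ⊑ h e → Emin e i
  ⊑⇒collapse-emin em {e} {i} ei ie with min-or-empty em e | min-or-empty em i
  ... | inj₁ (m , minₑ)  | inj₁ (m' , minᵢ) =
    inj₁ (m , minₑ , subst (IsMinW i) (≤-antisym (min≤ minₑ minᵢ ei) (min≤ minᵢ minₑ ie)) minᵢ)
  ... | inj₁ (m , minₑ)  | inj₂ emptyᵢ      = ⊥-elim (min-nonempty minₑ emptyᵢ ei)
  ... | inj₂ emptyₑ      | inj₁ (m' , minᵢ) = ⊥-elim (min-nonempty minᵢ emptyₑ ie)
  ... | inj₂ emptyₑ      | inj₂ emptyᵢ      = inj₂ (emptyₑ , emptyᵢ)

theorem3p5 : ExcludedMiddle 0ℓ → _≅CM₁_ ≡c Emin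
theorem3p5 em = iso≤emin congruence-enumerator , emin≤iso collapser
  where
  iso≤emin : (∃ λ h → Computable h × EnumeratesCongruence h) → _≅CM₁_ ≤c Emin
  iso≤emin (h , computable , spec) = h , computable , λ e i →
    (λ I → ⊑⇒emin em spec (iso⇒⊑ I) (iso⇒⊑ (iso-sym I))) ,
    (λ E → ⊑⇒iso (emin⇒⊑ spec E) (emin⇒⊑ spec (emin-sym E)))
  emin≤iso : (∃ λ h → Computable h × Collapses h) → Emin ≤c _≅CM₁_
  emin≤iso (h , computable , spec) = h , computable , λ e i →
    (λ E → ⊑⇒iso (emin⇒collapse-⊑ spec E) (emin⇒collapse-⊑ spec (emin-sym E))) ,
    (λ I → ⊑⇒collapse-emin spec em (iso⇒⊑ I) (iso⇒⊑ (iso-sym I)))
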